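{- $\Sigma$ is closed under the smash product $\#$.
   Context: Let $\mathcal{S}=\bigoplus_{n\ge0}\Bbbk S_n$ over a field of characteristic $0$, with each $\sigma\in S_n$ viewed as the endomorphism $v_1\cdots v_n\mapsto v_{\sigma(1)}\cdots v_{\sigma(n)}$ of $V^{\otimes n}$ in the tensor Hopf algebra $T(V)$ ($\dim V=\infty$, $v\mapsto 1\otimes v+v\otimes 1$). The smash product $\#$ on $\mathcal{S}$ is the restriction of the smash product of endomorphisms $f\# g=m\circ(1\otimes g)\circ(1\otimes m)\circ\mathrm{cyclic}\circ(\Delta\otimes1)\circ(f\otimes1)\circ\Delta$ of $T(V)$ (with $\mathrm{cyclic}(x\otimes y\otimes z)=y\otimes z\otimes x$), under which $\mathcal{S}$ is closed. For $\sigma\in S_n$ let $\operatorname{Des}(\sigma)=\{i\in[n-1]:\sigma(i)>\sigma(i+1)\}$, and for $J\subseteq[n-1]$ let $X_J=\sum_{\sigma\in S_n,\ \operatorname{Des}(\sigma)\subseteq J}\sigma$; index these by compositions via $(a_1,\ldots,a_r)\leftrightarrow\{a_1,a_1+a_2,\ldots,a_1+\cdots+a_{r-1}\}$. Let $\Sigma_n\subseteq\Bbbk S_n$ be the span of the $X_\alpha$, $\alpha$ a composition of $n$, and $\Sigma=\bigoplus_{n\ge0}\Sigma_n$. -}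

module Defs where

open import Level using (Level; _⊔_; suc)
open import Algebra.Bundles using (CommutativeRing)
open import Data.Nat as ℕ using (ℕ; zero; _∸_; _≟_; _<ᵇ_)
import Data.Nat
open import Data.Fin using (Fin; toℕ; inject₁; cast)
open import Data.Fin.Permutation using (Permutation′; _⟨$⟩ʳ_)
open import Data.Bool using (Bool; true; false; if_then_else_; _∧_; not; _∨_)
open import Data.List using (List; []; _∷_; _++_; concatMap; map; foldr; tabulate; lookup; length; allFin)
open import Data.Bool.ListAction using (and)
import Data.List.Properties as LP
open import Data.Vec using (Vec; []; _∷_) renaming (lookup to vlookup)
open import Data.Product using (Σ; ∃; _×_; _,_)
open import Relation.Nullary using (¬_; yes; no)
open import Relation.Binary.PropositionalEquality using (_≡_; sym)

ntimes : ∀ {c ℓ} (R : CommutativeRing c ℓ) → ℕ → CommutativeRing.Carrier R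
ntimes R zero = CommutativeRing.0# R
ntimes R (Data.Nat.suc n) = CommutativeRing._+_ R (CommutativeRing.1# R) (ntimes R n)

record Char0Field (c ℓ : Level) : Set (Level.suc (c ⊔ ℓ)) where
  field
    cring : CommutativeRing c ℓ
  open CommutativeRing cring using (Carrier; _≈_; _*_; 0#; 1#)
  field
    nontrivial : ¬ (1# ≈ 0#)
    inverse    : ∀ x → ¬ (x ≈ 0#) → ∃ λ y → x * y ≈ 1#
    char0      : ∀ n → ¬ (ntimes cring (Data.Nat.suc n) ≈ 0#)

-- Words in the letters of a basis (v_i)_{i ∈ ℕ} of the infinite-dimensional V.
Word : Set
Word = List ℕ

allSubsets : (k : ℕ) → List (Vec Bool k)
allSubsets zero = [] ∷ []
allSubsets (Data.Nat.suc k) = concatMap (λ J → (true ∷ J) ∷ (false ∷ J) ∷ []) (allSubsets k)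

-- Boolean: Des(σ) ⊆ J, where J ⊆ [k-1] is a boolean vector of length k ∸ 1
-- (entry i ↔ position i+1, i.e. descent between σ(i+1) and σ(i+2) in 1-based notation).
desSubset : (k : ℕ) → Permutation′ k → Vec Bool (k ∸ 1) → Bool
desSubset zero σ J = true
desSubset (Data.Nat.suc k) σ J =
  and (map (λ i → not (toℕ (σ ⟨$⟩ʳ Data.Fin.suc i) <ᵇ toℕ (σ ⟨$⟩ʳ inject₁ i)) ∨ vlookup J i)
           (allFin k))

module WithRing {c ℓ : Level} (R : CommutativeRing c ℓ) where
  open CommutativeRing R using (Carrier; _≈_; _+_; _*_; 0#; 1#)

  -- finite formal linear combinations of words (elements of T(V)), of
  -- T(V)⊗T(V) and of T(V)⊗T(V)⊗T(V)
  T1 : Set c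
  T1 = List (Carrier × Word)
  T2 : Set c
  T2 = List (Carrier × Word × Word)
  T3 : Set c
  T3 = List (Carrier × Word × Word × Word)

  -- linear endomorphisms of T(V), given by their values on basis words
  End : Set c
  End = Word → T1

  sumK : List Carrier → Carrier
  sumK = foldr _+_ 0#

  coeff : Word → T1 → Carrier
  coeff w [] = 0#
  coeff w ((a , u) ∷ t) with LP.≡-dec _≟_ w u
  ... | yes _ = a + coeff w t
  ... | no _  = coeff w t

  -- coproduct of T(V): the algebra map with Δ(v) = 1⊗v + v⊗1
  Δ : Word → T2
  Δ [] = (1# , [] , []) ∷ []
  Δ (a ∷ w) = concatMap (λ { (d , u , u') → (d , a ∷ u , u') ∷ (d , u , a ∷ u') ∷ [] }) (Δ w)

  f⊗1 : End → T2 → T2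
  f⊗1 f = concatMap (λ { (c₁ , a , b) → map (λ { (d , a') → (c₁ * d , a' , b) }) (f a) })
  Δ⊗1 : T2 → T3
  Δ⊗1 = concatMap (λ { (c₁ , a , b) → map (λ { (d , x , y) → (c₁ * d , x , y , b) }) (Δ a) })
  cyclic : T3 → T3
  cyclic = map (λ { (c₁ , x , y , z) → (c₁ , y , z , x) })
  1⊗m : T3 → T2
  1⊗m = map (λ { (c₁ , x , y , z) → (c₁ , x , y ++ z) })
  1⊗g : End → T2 → T2
  1⊗g g = concatMap (λ { (c₁ , a , b) → map (λ { (d , b') → (c₁ * d , a , b') }) (g b) })
  m : T2 → T1
  m = map (λ { (c₁ , a , b) → (c₁ , a ++ b) })

  _#_ : End → End → End
  (f # g) w = m (1⊗g g (1⊗m (cyclic (Δ⊗1 (f⊗1 f (Δ w))))))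

  -- elements of 𝒮 = ⊕ₙ 𝕜Sₙ as finite linear combinations of permutations
  SElem : Set c
  SElem = List (Carrier × Σ ℕ Permutation′)

  act : {n : ℕ} → Permutation′ n → (w : Word) → length w ≡ n → Word
  act σ w eq = tabulate (λ i → lookup w (cast (sym eq) (σ ⟨$⟩ʳ i)))

  endo : SElem → End
  endo x w = concatMap step x
    where
      step : Carrier × Σ ℕ Permutation′ → T1
      step (a , n , σ) with length w ≟ n
      ... | yes eq = (a , act σ w eq) ∷ []
      ... | no _   = []

  -- coefficient of σ ∈ S_k in an endomorphism F ∈ 𝒮 (well defined since dim V = ∞):
  -- coefficient of the word v_{σ(1)}⋯v_{σ(k)} in F(v₁⋯v_k)
  -- (letters v₁,…,v_k are encoded as 0,…,k-1).
  coeffPerm : End → (k : ℕ) → Permutation′ k → Carrier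
  coeffPerm F k σ = coeff (tabulate (λ i → toℕ (σ ⟨$⟩ʳ i))) (F (tabulate {n = k} toℕ))

  -- coefficient of σ in X_J = Σ_{Des(τ) ⊆ J} τ
  XJcoeff : (k : ℕ) → Vec Bool (k ∸ 1) → Permutation′ k → Carrier
  XJcoeff k J σ = if desSubset k σ J then 1# else 0#

  -- F (an element of 𝒮) lies in Σ = ⊕ₖ Σₖ: in each degree k, F's component is
  -- a 𝕜-linear combination Σ_J c_J X_J over J ⊆ [k-1]
  InΣ : End → Set (c ⊔ ℓ)
  InΣ F = ∀ (k : ℕ) → ∃ λ (cJ : Vec Bool (k ∸ 1) → Carrier) →
            ∀ (σ : Permutation′ k) →
              coeffPerm F k σ ≈ sumK (map (λ J → cJ J * XJcoeff k J σ) (allSubsets (k ∸ 1)))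

-- X_α is the convolution product of the projections of T(V) onto its components of
-- degrees α₁, …, α_r: it deals the letters of a word into r subwords of these lengths
-- and concatenates them. Since Δ is a cocommutative algebra map, Δ ∘ X_α is the sum of
-- (X_α′ ⊗ X_α″) ∘ Δ over all α = α′ + α″. In X_α # X_β every letter is thus dealt into
-- one of finitely many classes, and the output concatenates the classes in a fixed
-- order, so grouping by the class sizes gives a sum of X_γ's (γ with zero parts allowed).
-- On words v₁⋯v_k, the coefficient of σ in X_γ is 1 or 0 according to whether σ
-- increases on the consecutive blocks of lengths γ₁, γ₂, …, that is, whether Des(σ) is
-- contained in the set of partial sums of γ.
module Submission where

open import Defs
open import Level using (Level; _⊔_)
open import Algebra.Bundles using (CommutativeRing)
open import Data.Bool as Bool using (Bool; true; false; if_then_else_; T; not; _∧_; _∨_)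
open import Data.Bool.ListAction using (and)
open import Data.Fin using (Fin; zero; suc; toℕ; inject₁; cast)
open import Data.Fin.Permutation as Perm using (Permutation′; _⟨$⟩ʳ_; _∘ₚ_)
import Data.Fin.Properties as Fin
open import Data.List using
  (List; []; _∷_; _++_; concatMap; map; length; take; drop; lookup; tabulate; deduplicate; upTo)
import Data.List.Properties as List
open import Data.List.Membership.Propositional using (_∈_; _∉_; find)
open import Data.List.Membership.Propositional.Properties
  using (∈-++⁺ˡ; ∈-++⁺ʳ; ∈-++⁻; ∈-concatMap⁻; ∈-deduplicate⁺; ∈-deduplicate⁻; ∈-map⁻;
         ∈-tabulate⁺; ∈-upTo⁺; ∈-upTo⁻)
open import Data.List.Relation.Unary.All as All using (All; []; _∷_)
import Data.List.Relation.Unary.All.Properties as All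
open import Data.List.Relation.Unary.AllPairs as AllPairs using (AllPairs; []; _∷_)
import Data.List.Relation.Unary.AllPairs.Properties as AllPairs
open import Data.List.Relation.Unary.Any using (here; there)
open import Data.List.Relation.Unary.Linked using (Linked; []; [-]; _∷_)
import Data.List.Relation.Unary.Linked.Properties as Linked
open import Data.List.Relation.Unary.Unique.Propositional using (Unique)
import Data.List.Relation.Unary.Unique.Propositional.Properties as Unique
import Data.List.Relation.Unary.Unique.DecPropositional.Properties as DecUnique
open import Data.List.Relation.Binary.Permutation.Homogeneous using (onIndices)
open import Data.List.Relation.Binary.Permutation.Propositional using (_↭_; ↭-refl; ↭-sym; ↭-trans; ↭⇒↭ₛ)
open import Data.List.Relation.Binary.Permutation.Propositional.Properties
  using (↭-length; ++⁺ˡ; All-resp-↭; ∈-resp-↭)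
import Data.List.Relation.Binary.Permutation.Setoid.Properties as ↭ₛ
open import Data.List.Relation.Ternary.Interleaving.Propositional
  using (Interleaving; []; consˡ; consʳ; toPermutation)
open import Data.Nat as ℕ using (ℕ; zero; suc; _≡ᵇ_; _<_; _≤_; _<ᵇ_; _∸_; s≤s)
open import Data.Nat.ListAction using (sum)
import Data.Nat.Properties as ℕ
open import Data.Product using (Σ; ∃; _×_; _,_; -,_; proj₁; proj₂; uncurry; map₁; map₂)
open import Data.Sum as Sum using (_⊎_; inj₁; inj₂)
open import Data.Unit using (⊤; tt)
open import Data.Vec as Vec using (Vec; []; _∷_) renaming (lookup to vlookup)
import Data.Vec.Properties as Vec
open import Function using (_∘_; _⇔_; mk⇔; Equivalence)
open import Relation.Binary.PropositionalEquality as ≡ using (_≡_; _≢_; cong; cong₂; subst; subst₂)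
open import Relation.Nullary using (Dec; yes; no; does; ¬_; contradiction; ofʸ; ofⁿ)
open import Relation.Nullary.Decidable using (dec-true; dec-false)

-- `InΣ` speaks only of the words 0 1 ... k-1, while the smash product applies its factors to
-- subwords and to products v x on other letters. The span is therefore described again by `XSpan`,
-- on all words at once. The passage works because permutations and X_α move positions without
-- looking at letters: both commute with substitutions of letters, and every word is a substitution
-- instance of 0 1 ... n-1. The classes of letters in X_α # X_β are the cells of a matrix of natural
-- numbers. Its rows are the letters that X_α does not receive and the parts of α. Its columns are
-- the tensor factor of Δ ∘ X_α that is output directly, with no cell in the first row, and then the
-- parts of β. Rows belonging to α have the prescribed sums α, columns belonging to β the prescribed
-- sums β, and γ reads the matrix column by column; this is the analogue of Solomon's rule for the
-- product of descent sums. `absorb` builds the columns of β one at a time and, when β is exhausted,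
-- requires the remainder of α to be zero. Empty cells stay in γ as zero parts, and `boundaries`
-- forgets them at the end.

private variable
  a b r : Level
  A : Set a
  B : Set b

-- Deshuffles, the operators X_α, and the indices of their products

-- The terms of Δ(w) with multiplicity. All coefficients of Δ are 1 and are left out here; `⟪Δ⟫`
-- makes the comparison.
deshuffles : Word → List (Word × Word)
deshuffles []      = ([] , []) ∷ []
deshuffles (l ∷ w) = concatMap (λ (u , v) → (l ∷ u , v) ∷ (u , l ∷ v) ∷ []) (deshuffles w)

-- X α w lists the words of X_α(w) with multiplicity; X_α = 0 off degree sum α.
X : List ℕ → Word → List Word
X []      []      = [] ∷ []
X []      (_ ∷ _) = []
X (a ∷ α) w       =
  concatMap (λ (u , v) → if length u ≡ᵇ a then map (u ++_) (X α v) else []) (deshuffles w)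

splitsℕ : ℕ → List (ℕ × ℕ)
splitsℕ zero    = (0 , 0) ∷ []
splitsℕ (suc n) = (0 , suc n) ∷ map (map₁ suc) (splitsℕ n)

splits : List ℕ → List (List ℕ × List ℕ)
splits []      = ([] , []) ∷ []
splits (a ∷ α) =
  concatMap (λ (a₁ , a₂) → map (λ (α₁ , α₂) → a₁ ∷ α₁ , a₂ ∷ α₂) (splits α)) (splitsℕ a)

-- ∑_γ X_γ over γ ∈ heads b α is w ↦ ∑ u · X_α(v), over the (u , v) in Δ(w) for which
-- the product has degree b.
heads : ℕ → List ℕ → List (List ℕ)
heads b α = concatMap (λ (b₁ , b₂) → if sum α ≡ᵇ b₂ then (b₁ ∷ α) ∷ [] else []) (splitsℕ b)

-- ∑_γ X_γ over γ ∈ absorb α β is w ↦ ∑ X_β(u · X_α(v)), over the (u , v) in Δ(w).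
absorb : List ℕ → List ℕ → List (List ℕ)
absorb α []      = heads 0 α
absorb α (b ∷ β) =
  concatMap (λ (α₁ , α₂) → concatMap (λ γ → map (γ ++_) (absorb α₂ β)) (heads b α₁)) (splits α)

-- X_α # X_β is the sum of the X_γ over γ ∈ smash α β.
smash : List ℕ → List ℕ → List (List ℕ)
smash α β = concatMap (λ (α₁ , α₂) → map (α₂ ++_) (absorb α₁ β)) (splits α)

deshuffles-interleaving : ∀ w {u v} → (u , v) ∈ deshuffles w → Interleaving u v w
deshuffles-interleaving []      (here ≡.refl) = []
deshuffles-interleaving (l ∷ w) uv∈ with ∈-concatMap⁻ _ {xs = deshuffles w} uv∈
... | uv∈′ with find uv∈′
... | _ , st∈ , here ≡.refl         = consˡ (deshuffles-interleaving w st∈)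
... | _ , st∈ , there (here ≡.refl) = consʳ (deshuffles-interleaving w st∈)

deshuffles-length : ∀ w {u v} → (u , v) ∈ deshuffles w → length w ≡ length u ℕ.+ length v
deshuffles-length w {u} uv∈ =
  ≡.trans (↭-length (toPermutation (deshuffles-interleaving w uv∈))) (List.length-++ u)

∈-if⁻ : ∀ p {xs : List A} {x} → x ∈ (if p then xs else []) → p ≡ true × x ∈ xs
∈-if⁻ true x∈ = ≡.refl , x∈

∈-X-∷⁻ : ∀ a α w {x} → x ∈ X (a ∷ α) w →
         ∃ λ u → ∃ λ v → ∃ λ y → (u , v) ∈ deshuffles w × length u ≡ a × y ∈ X α v × x ≡ u ++ y
∈-X-∷⁻ a α w x∈ with find (∈-concatMap⁻ _ {xs = deshuffles w} x∈)
... | (u , v) , uv∈ , x∈uv with ∈-if⁻ (length u ≡ᵇ a) x∈uv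
... | |u|≡a , x∈map with ∈-map⁻ (u ++_) x∈map
... | y , y∈ , x≡ = u , v , y , uv∈ , ℕ.≡ᵇ⇒≡ _ _ (subst T (≡.sym |u|≡a) _) , y∈ , x≡

X-length : ∀ α w {x} → x ∈ X α w → length x ≡ sum α
X-length []      []      (here ≡.refl) = ≡.refl
X-length (a ∷ α) w       x∈ with ∈-X-∷⁻ a α w x∈
... | u , v , y , _ , |u|≡a , y∈ , ≡.refl =
  ≡.trans (List.length-++ u) (cong₂ ℕ._+_ |u|≡a (X-length α v y∈))

X-↭ : ∀ α w {x} → x ∈ X α w → x ↭ w
X-↭ []      []      (here ≡.refl) = ↭-refl
X-↭ (a ∷ α) w       x∈ with ∈-X-∷⁻ a α w x∈
... | u , v , y , uv∈ , _ , y∈ , ≡.refl =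
  ↭-trans (++⁺ˡ u (X-↭ α v y∈)) (↭-sym (toPermutation (deshuffles-interleaving w uv∈)))

-- Permutations in one-line notation

identityWord : ℕ → Word
identityWord n = tabulate {n = n} toℕ

permWord : ∀ {n} → Permutation′ n → Word
permWord σ = tabulate (λ i → toℕ (σ ⟨$⟩ʳ i))

tabulate-cast : ∀ {m n} (eq : m ≡ n) (f : Fin n → A) → tabulate (f ∘ cast eq) ≡ tabulate f
tabulate-cast ≡.refl f = List.tabulate-cong (cong f ∘ Fin.cast-is-id ≡.refl)

lookup-identityWord : ∀ n i → lookup (identityWord n) i ≡ toℕ i
lookup-identityWord n i = begin
  lookup (identityWord n) i
    ≡⟨ cong (lookup (identityWord n)) (Fin.cast-involutive (≡.sym eq) eq i) ⟨
  lookup (identityWord n) (cast (≡.sym eq) (cast eq i)) ≡⟨ List.lookup-tabulate toℕ (cast eq i) ⟩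
  toℕ (cast eq i)           ≡⟨ Fin.toℕ-cast eq i ⟩
  toℕ i                     ∎
  where
  open ≡.≡-Reasoning
  eq = List.length-tabulate {n = n} toℕ

-- The rearrangement matches position i of s with the position of the same letter in 0 1 ... n-1,
-- which is that letter itself. The casts only move this bijection from the lengths of the words to
-- n.
↭-identityWord⇒permWord : ∀ n {s} → s ↭ identityWord n → ∃ λ (σ : Permutation′ n) → s ≡ permWord σ
↭-identityWord⇒permWord n {s} s↭ = σ , ≡.sym (begin
  tabulate (λ i → toℕ (cast _ (π ⟨$⟩ʳ cast _ i))) ≡⟨ List.tabulate-cong (λ i → Fin.toℕ-cast _ (π ⟨$⟩ʳ cast _ i)) ⟩
  tabulate (λ i → toℕ (π ⟨$⟩ʳ cast _ i))          ≡⟨ tabulate-cast (≡.sym |s|≡n) (λ i → toℕ (π ⟨$⟩ʳ i)) ⟩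
  tabulate (λ i → toℕ (π ⟨$⟩ʳ i))
    ≡⟨ List.tabulate-cong (λ i → ≡.trans (↭ₛ.onIndices-lookup (≡.setoid ℕ) (↭⇒↭ₛ s↭) i) (lookup-identityWord n _)) ⟨
  tabulate (lookup s)                             ≡⟨ List.tabulate-lookup s ⟩
  s                                               ∎)
  where
  open ≡.≡-Reasoning
  π = onIndices (↭⇒↭ₛ s↭)
  |id|≡n = List.length-tabulate {n = n} toℕ
  |s|≡n : length s ≡ n
  |s|≡n = ≡.trans (↭ₛ.xs↭ys⇒|xs|≡|ys| (≡.setoid ℕ) (↭⇒↭ₛ s↭)) |id|≡n
  σ : Permutation′ n
  σ = Perm.cast-id (≡.sym |s|≡n) ∘ₚ π ∘ₚ Perm.cast-id |id|≡n

permWord-injective : ∀ {n} (σ : Permutation′ n) {i j} → toℕ (σ ⟨$⟩ʳ i) ≡ toℕ (σ ⟨$⟩ʳ j) → i ≡ j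
permWord-injective σ {i} {j} eq = begin
  i                            ≡⟨ Perm.inverseˡ σ ⟨
  σ Perm.⟨$⟩ˡ (σ ⟨$⟩ʳ i)       ≡⟨ cong (σ Perm.⟨$⟩ˡ_) (Fin.toℕ-injective eq) ⟩
  σ Perm.⟨$⟩ˡ (σ ⟨$⟩ʳ j)       ≡⟨ Perm.inverseˡ σ ⟩
  j                            ∎
  where open ≡.≡-Reasoning

identityWord-sorted : ∀ n → AllPairs _<_ (identityWord n)
identityWord-sorted n = AllPairs.tabulate⁺-< (λ i<j → i<j)

-- Descent sets and increasing blocks

-- Increasing on consecutive segments of lengths γ₁, γ₂, …;
-- only meaningful on words of length sum γ, since take and drop truncate.
Blocks : List ℕ → Word → Set
Blocks []      s = ⊤
Blocks (a ∷ γ) s = Linked _<_ (take a s) × Blocks γ (drop a s)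

-- The subset {γ₁, γ₁+γ₂, …} of [n] attached to a weak composition γ of n+1.
boundaries : List ℕ → (n : ℕ) → Vec Bool n
boundaries []                n       = Vec.replicate n true
boundaries (zero ∷ γ)        n       = boundaries γ n
boundaries (suc a ∷ γ)       zero    = []
boundaries (suc zero ∷ γ)    (suc n) = true ∷ boundaries γ n
boundaries (suc (suc a) ∷ γ) (suc n) = false ∷ boundaries (suc a ∷ γ) n

blocks-[] : ∀ γ → Blocks γ []
blocks-[] []          = tt
blocks-[] (zero ∷ γ)  = [] , blocks-[] γ
blocks-[] (suc _ ∷ γ) = [] , blocks-[] γ

-- A first part 1 puts a boundary after the first position, where any descent is allowed. A first
-- part of at least 2 forbids a descent there, which for distinct letters is a strict increase.
-- Dropping the first letter then shortens the first part by one.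
blocks⇔descents : ∀ n γ (f : Fin (suc n) → ℕ) → (∀ {i j} → f i ≡ f j → i ≡ j) → sum γ ≡ suc n →
  Blocks γ (tabulate f) ⇔ (∀ i → f (suc i) < f (inject₁ i) → vlookup (boundaries γ n) i ≡ true)
blocks⇔descents n       (zero ∷ γ)        f inj eq = mk⇔ (to ∘ proj₂) (λ d → [] , from d)
  where open Equivalence (blocks⇔descents n γ f inj eq)
blocks⇔descents zero    (1 ∷ γ)           f inj eq = mk⇔ (λ _ ()) (λ _ → [-] , blocks-[] γ)
blocks⇔descents (suc n) (1 ∷ γ)           f inj eq =
  mk⇔ (λ { (_ , b) zero _ → ≡.refl ; (_ , b) (suc i) → to b i }) (λ d → [-] , from (d ∘ suc))
  where open Equivalence (blocks⇔descents n γ (f ∘ suc) (Fin.suc-injective ∘ inj) (ℕ.suc-injective eq))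
blocks⇔descents (suc n) (suc (suc a) ∷ γ) f inj eq =
  mk⇔ (λ { (f₀<f₁ ∷ l , b) zero f₁<f₀ → contradiction f₁<f₀ (ℕ.<-asym f₀<f₁)
         ; (f₀<f₁ ∷ l , b) (suc i)     → to (l , b) i })
      (λ d → let (l , b) = from (d ∘ suc) in f₀<f₁ d ∷ l , b)
  where
  open Equivalence (blocks⇔descents n (suc a ∷ γ) (f ∘ suc) (Fin.suc-injective ∘ inj) (ℕ.suc-injective eq))
  f₀<f₁ : (∀ i → f (suc i) < f (inject₁ i) → vlookup (false ∷ boundaries (suc a ∷ γ) n) i ≡ true) →
          f zero < f (suc zero)
  f₀<f₁ d = ℕ.≤∧≢⇒< (ℕ.≮⇒≥ λ f₁<f₀ → contradiction (d zero f₁<f₀) λ ())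
                    (λ f₀≡f₁ → contradiction (inj f₀≡f₁) λ ())

and-tabulate⇔ : ∀ {n} (g : Fin n → Bool) → and (tabulate g) ≡ true ⇔ (∀ i → g i ≡ true)
and-tabulate⇔ {zero}  g = mk⇔ (λ _ ()) (λ _ → ≡.refl)
and-tabulate⇔ {suc n} g with g zero in g₀
... | true  = mk⇔ (λ { p zero → g₀ ; p (suc i) → to p i }) (λ p → from (p ∘ suc))
  where open Equivalence (and-tabulate⇔ (g ∘ suc))
... | false = mk⇔ (λ ()) (λ p → ≡.trans (≡.sym g₀) (p zero))

<ᵇ-∨⇔ : ∀ m n b → (not (m <ᵇ n) ∨ b ≡ true) ⇔ (m < n → b ≡ true)
<ᵇ-∨⇔ m n b with m <ᵇ n | ℕ.<ᵇ-reflects-< m n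
... | true  | ofʸ m<n = mk⇔ (λ p _ → p) (λ p → p m<n)
... | false | ofⁿ m≮n = mk⇔ (λ _ m<n → contradiction m<n m≮n) (λ _ → ≡.refl)

desSubset⇔descents : ∀ n (σ : Permutation′ (suc n)) J → desSubset (suc n) σ J ≡ true ⇔
  (∀ i → toℕ (σ ⟨$⟩ʳ suc i) < toℕ (σ ⟨$⟩ʳ inject₁ i) → vlookup J i ≡ true)
desSubset⇔descents n σ J = mk⇔
  (λ p i → Equivalence.to (<ᵇ-∨⇔ _ _ _) (Equivalence.to (and-tabulate⇔ _) (≡.trans (≡.sym and-eq) p) i))
  (λ d → ≡.trans and-eq (Equivalence.from (and-tabulate⇔ _) (λ i → Equivalence.from (<ᵇ-∨⇔ _ _ _) (d i))))
  where and-eq = cong and (List.map-tabulate {n = n} (λ i → i) _)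

desSubset⇔blocks : ∀ k γ (σ : Permutation′ k) → sum γ ≡ k →
                   desSubset k σ (boundaries γ (k ∸ 1)) ≡ true ⇔ Blocks γ (permWord σ)
desSubset⇔blocks zero    γ σ eq = mk⇔ (λ _ → blocks-[] γ) (λ _ → ≡.refl)
desSubset⇔blocks (suc n) γ σ eq =
  mk⇔ (B.from ∘ D.to) (D.from ∘ B.to)
  where
  module B = Equivalence (blocks⇔descents n γ _ (permWord-injective σ) eq)
  module D = Equivalence (desSubset⇔descents n σ (boundaries γ n))

-- From subsets to compositions

bump : List ℕ → List ℕ
bump []      = []
bump (a ∷ γ) = suc a ∷ γ

parts : ∀ {n} → Vec Bool n → List ℕ
parts []          = 1 ∷ []
parts (true ∷ J)  = 1 ∷ parts J
parts (false ∷ J) = bump (parts J)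

-- Degrees 0 and 1 have the same single index, the subset of the empty set. The degree decides
-- between the empty composition and the composition 1.
composition : ∀ k → Vec Bool (k ∸ 1) → List ℕ
composition zero    J = []
composition (suc n) J = parts J

-- `bump` raises the sum only of a nonempty list. The head is exhibited as a successor so that the
-- bumped list falls under the `false` clause of `boundaries`.
parts-nonempty : ∀ {n} (J : Vec Bool n) → ∃ λ a → ∃ λ γ → parts J ≡ suc a ∷ γ
parts-nonempty []          = -, -, ≡.refl
parts-nonempty (true ∷ J)  = -, -, ≡.refl
parts-nonempty (false ∷ J) with parts J | parts-nonempty J
... | _ | _ , _ , ≡.refl = -, -, ≡.refl

sum-parts : ∀ {n} (J : Vec Bool n) → sum (parts J) ≡ suc n
sum-parts []          = ≡.refl
sum-parts (true ∷ J)  = cong suc (sum-parts J)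
sum-parts (false ∷ J) with parts J | parts-nonempty J | sum-parts J
... | _ | _ , _ , ≡.refl | eq = cong suc eq

sum-composition : ∀ k J → sum (composition k J) ≡ k
sum-composition zero    J = ≡.refl
sum-composition (suc n) J = sum-parts J

boundaries-parts : ∀ {n} (J : Vec Bool n) → boundaries (parts J) n ≡ J
boundaries-parts []          = ≡.refl
boundaries-parts (true ∷ J)  = cong (true ∷_) (boundaries-parts J)
boundaries-parts (false ∷ J) with parts J | parts-nonempty J | boundaries-parts J
... | _ | _ , _ , ≡.refl | eq = cong (false ∷_) eq

boundaries-composition : ∀ k J → boundaries (composition k J) (k ∸ 1) ≡ J
boundaries-composition zero    [] = ≡.refl
boundaries-composition (suc n) J  = boundaries-parts J

-- Subwords of sorted words, and substitution of letters

interleaving-AllPairs : ∀ {R : A → A → Set r} {u v w} → Interleaving u v w →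
                        AllPairs R w → AllPairs R u × AllPairs R v
interleaving-AllPairs []        []        = [] , []
interleaving-AllPairs {u = x ∷ u} (consˡ i) (x~w ∷ w) =
  map₁ (All.++⁻ˡ u (All-resp-↭ (toPermutation i) x~w) ∷_) (interleaving-AllPairs i w)
interleaving-AllPairs {u = u} (consʳ i) (x~w ∷ w) =
  map₂ (All.++⁻ʳ u (All-resp-↭ (toPermutation i) x~w) ∷_) (interleaving-AllPairs i w)

-- Greedy matching. The later letters of p exceed its head, so once the head of w has been matched
-- or passed over, none of them can equal it and all are still found in the tail of w.
sorted⇒interleaving : ∀ p w → AllPairs _<_ p → AllPairs _<_ w → All (_∈ w) p → ∃ λ v → Interleaving p v w
sorted⇒interleaving []      []      _          _          _  = -, []
sorted⇒interleaving []      (x ∷ w) p          (_ ∷ w<)   _  =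
  -, consʳ (proj₂ (sorted⇒interleaving [] w p w< []))
sorted⇒interleaving (y ∷ p) (x ∷ w) (y<p ∷ p<) (x<w ∷ w<) (here ≡.refl ∷ p⊆) =
  -, consˡ (proj₂ (sorted⇒interleaving p w p< w< (All.zipWith shrink (y<p , p⊆))))
  where
  shrink : ∀ {z} → x < z × z ∈ x ∷ w → z ∈ w
  shrink (x<z , here ≡.refl) = contradiction x<z (ℕ.<-irrefl ≡.refl)
  shrink (_   , there z∈)    = z∈
sorted⇒interleaving (y ∷ p) (x ∷ w) (y<p ∷ p<) (x<w ∷ w<) (there y∈ ∷ p⊆) =
  -, consʳ (proj₂ (sorted⇒interleaving (y ∷ p) w (y<p ∷ p<) w< (y∈ ∷ All.zipWith shrink (y<p , p⊆))))
  where
  x<y = All.lookup x<w y∈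
  shrink : ∀ {z} → y < z × z ∈ x ∷ w → z ∈ w
  shrink (y<z , here ≡.refl) = contradiction y<z (ℕ.<-asym x<y)
  shrink (_   , there z∈)    = z∈

lookup-map-cast : ∀ (g : A → B) xs {n} .{eq : n ≡ length (map g xs)} .{eq′ : n ≡ length xs} i →
                  lookup (map g xs) (cast eq i) ≡ g (lookup xs (cast eq′ i))
lookup-map-cast g (x ∷ xs) zero    = ≡.refl
lookup-map-cast g (x ∷ xs) (suc i) = lookup-map-cast g xs i

-- The substitution i ↦ w_i that carries 0 1 ... n-1 to w. The value 0 beyond the end of w makes it
-- total.
nth : Word → ℕ → ℕ
nth []      _       = 0
nth (l ∷ w) zero    = l
nth (l ∷ w) (suc i) = nth w i

map-nth-identityWord : ∀ w → map (nth w) (identityWord (length w)) ≡ w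
map-nth-identityWord w = ≡.trans (List.map-tabulate toℕ (nth w))
  (≡.trans (List.tabulate-cong (nth-lookup w)) (List.tabulate-lookup w))
  where
  nth-lookup : ∀ w i → nth w (toℕ i) ≡ lookup w i
  nth-lookup (l ∷ w) zero    = ≡.refl
  nth-lookup (l ∷ w) (suc i) = nth-lookup w i

unique-++-disjoint : ∀ (p : List A) {q z} → Unique (p ++ q) → z ∈ p → z ∉ q
unique-++-disjoint (x ∷ p) (x∉ ∷ _) (here ≡.refl) z∈q = All.lookup x∉ (∈-++⁺ʳ p z∈q) ≡.refl
unique-++-disjoint (x ∷ p) (_ ∷ pq!) (there z∈p)  z∈q = unique-++-disjoint p pq! z∈p z∈q

-- Renews the hypotheses of `blocks-coeff` once the first block is cut off. As s has no repeated
-- letter, a letter of the rest is not in the block, so it survives in v.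
interleaving-drop : ∀ a {n} {v w s : List A} → Interleaving (take a s) v w → length (take a s) ≡ a →
  Unique s → All (_∈ w) s → length s ≡ length w → a ℕ.+ n ≡ length w →
  All (_∈ v) (drop a s) × length (drop a s) ≡ length v × n ≡ length v
interleaving-drop a {n} {v} {w} {s} i |p|≡a s! s⊆ |s|≡|w| a+n≡|w| =
  All.tabulate (λ z∈q → in-rest z∈q (∈-++⁻ p (∈-resp-↭ (toPermutation i) (All.lookup (All.drop⁺ a s⊆) z∈q)))) ,
  ℕ.+-cancelˡ-≡ a _ _ (≡.trans (≡.sym |s|≡) (≡.trans |s|≡|w| |w|≡)) ,
  ℕ.+-cancelˡ-≡ a _ _ (≡.trans a+n≡|w| |w|≡)
  where
  p = take a s
  q = drop a s

  p++q≡s : p ++ q ≡ s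
  p++q≡s = List.take++drop≡id a s

  in-rest : ∀ {z} → z ∈ q → z ∈ p ⊎ z ∈ v → z ∈ v
  in-rest z∈q (inj₁ z∈p) = contradiction z∈q (unique-++-disjoint p (subst Unique (≡.sym p++q≡s) s!) z∈p)
  in-rest z∈q (inj₂ z∈v) = z∈v

  |w|≡ : length w ≡ a ℕ.+ length v
  |w|≡ = ≡.trans (↭-length (toPermutation i)) (≡.trans (List.length-++ p) (cong (ℕ._+ length v) |p|≡a))

  |s|≡ : length s ≡ a ℕ.+ length q
  |s|≡ = ≡.trans (cong length (≡.sym p++q≡s)) (≡.trans (List.length-++ p) (cong (ℕ._+ length q) |p|≡a))

-- Finite sums and Boolean guards

module LinearCombinations {c ℓ : Level} (R : CommutativeRing c ℓ) where
  open CommutativeRing R hiding (zero; sym; trans)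
  open CommutativeRing R using () renaming (sym to ≈-sym; trans to ≈-trans)
  open WithRing R
  open import Relation.Binary.Reasoning.Setoid setoid
  open import Algebra.Properties.CommutativeSemigroup +-commutativeSemigroup using (interchange)

  ∑ : List A → (A → Carrier) → Carrier
  ∑ xs f = sumK (map f xs)

  ∑₂ : List (A × B) → (A → B → Carrier) → Carrier
  ∑₂ xs f = ∑ xs (uncurry f)

  ∑-cong-∈ : (xs : List A) {f g : A → Carrier} → (∀ {x} → x ∈ xs → f x ≈ g x) → ∑ xs f ≈ ∑ xs g
  ∑-cong-∈ []       f≈g = refl
  ∑-cong-∈ (x ∷ xs) f≈g = +-cong (f≈g (here ≡.refl)) (∑-cong-∈ xs (f≈g ∘ there))

  ∑-cong : (xs : List A) {f g : A → Carrier} → (∀ x → f x ≈ g x) → ∑ xs f ≈ ∑ xs g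
  ∑-cong xs f≈g = ∑-cong-∈ xs (λ {x} _ → f≈g x)

  ∑₂-cong : (xs : List (A × B)) {f g : A → B → Carrier} →
            (∀ x y → f x y ≈ g x y) → ∑₂ xs f ≈ ∑₂ xs g
  ∑₂-cong xs f≈g = ∑-cong xs (λ (x , y) → f≈g x y)

  ∑-zero : (xs : List A) → ∑ xs (λ _ → 0#) ≈ 0#
  ∑-zero []       = refl
  ∑-zero (x ∷ xs) = ≈-trans (+-identityˡ _) (∑-zero xs)

  ∑-distrib-+ : (xs : List A) (f g : A → Carrier) → ∑ xs (λ x → f x + g x) ≈ ∑ xs f + ∑ xs g
  ∑-distrib-+ []       f g = ≈-sym (+-identityˡ 0#)
  ∑-distrib-+ (x ∷ xs) f g = ≈-trans (+-congˡ (∑-distrib-+ xs f g)) (interchange _ _ _ _)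

  ∑-distribˡ : (xs : List A) (r : Carrier) (f : A → Carrier) → ∑ xs (λ x → r * f x) ≈ r * ∑ xs f
  ∑-distribˡ []       r f = ≈-sym (zeroʳ r)
  ∑-distribˡ (x ∷ xs) r f = ≈-trans (+-congˡ (∑-distribˡ xs r f)) (≈-sym (distribˡ r _ _))

  ∑-map : (g : A → B) (xs : List A) (f : B → Carrier) → ∑ (map g xs) f ≡ ∑ xs (f ∘ g)
  ∑-map g []       f = ≡.refl
  ∑-map g (x ∷ xs) f = cong (f (g x) +_) (∑-map g xs f)

  ∑-++ : (xs ys : List A) (f : A → Carrier) → ∑ (xs ++ ys) f ≈ ∑ xs f + ∑ ys f
  ∑-++ []       ys f = ≈-sym (+-identityˡ _)
  ∑-++ (x ∷ xs) ys f = ≈-trans (+-congˡ (∑-++ xs ys f)) (≈-sym (+-assoc _ _ _))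

  ∑-concatMap : (g : A → List B) (xs : List A) (f : B → Carrier) →
                ∑ (concatMap g xs) f ≈ ∑ xs (λ x → ∑ (g x) f)
  ∑-concatMap g []       f = refl
  ∑-concatMap g (x ∷ xs) f =
    ≈-trans (∑-++ (g x) (concatMap g xs) f) (+-congˡ (∑-concatMap g xs f))

  ∑-swap : (xs : List A) (ys : List B) (f : A → B → Carrier) →
           ∑ xs (λ x → ∑ ys (f x)) ≈ ∑ ys (λ y → ∑ xs (λ x → f x y))
  ∑-swap []       ys f = ≈-sym (∑-zero ys)
  ∑-swap (x ∷ xs) ys f =
    ≈-trans (+-congˡ (∑-swap xs ys f)) (≈-sym (∑-distrib-+ ys (f x) _))

  infixr 5 _▷_
  _▷_ : Bool → Carrier → Carrier
  p ▷ x = if p then x else 0#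

  ▷-cong : ∀ p {x y} → x ≈ y → p ▷ x ≈ p ▷ y
  ▷-cong true  x≈y = x≈y
  ▷-cong false _   = refl

  ▷-comm : ∀ p q x → p ▷ q ▷ x ≈ q ▷ p ▷ x
  ▷-comm true  q x = refl
  ▷-comm false true  x = refl
  ▷-comm false false x = refl

  ▷-∑ : ∀ p (xs : List A) (f : A → Carrier) → p ▷ ∑ xs f ≈ ∑ xs (λ x → p ▷ f x)
  ▷-∑ true  xs f = refl
  ▷-∑ false xs f = ≈-sym (∑-zero xs)

  ∑-if : ∀ p (xs : List A) (f : A → Carrier) → ∑ (if p then xs else []) f ≈ p ▷ ∑ xs f
  ∑-if true  xs f = refl
  ∑-if false xs f = refl

  -- The bialgebra axioms of T(V), paired with functionals

  -- Sweedler notation: `∑Δ w H` is the sum of H over the two tensor factors of Δ(w).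
  ∑Δ : Word → (Word → Word → Carrier) → Carrier
  ∑Δ w = ∑₂ (deshuffles w)

  ∑Δ-cong : ∀ w {f g : Word → Word → Carrier} → (∀ u v → f u v ≈ g u v) → ∑Δ w f ≈ ∑Δ w g
  ∑Δ-cong w = ∑₂-cong (deshuffles w)

  ∑Δ-∷ : ∀ l w (H : Word → Word → Carrier) →
         ∑Δ (l ∷ w) H ≈ ∑Δ w (λ u v → H (l ∷ u) v + H u (l ∷ v))
  ∑Δ-∷ l w H = ≈-trans (∑-concatMap _ (deshuffles w) _)
                       (∑Δ-cong w (λ u v → +-congˡ (+-identityʳ _)))

  ∑Δ-+ : ∀ w (H K : Word → Word → Carrier) → ∑Δ w (λ u v → H u v + K u v) ≈ ∑Δ w H + ∑Δ w K
  ∑Δ-+ w H K = ∑-distrib-+ (deshuffles w) (uncurry H) (uncurry K)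

  ∑Δ-∷′ : ∀ l w (H : Word → Word → Carrier) →
          ∑Δ (l ∷ w) H ≈ ∑Δ w (λ u v → H (l ∷ u) v) + ∑Δ w (λ u v → H u (l ∷ v))
  ∑Δ-∷′ l w H = ≈-trans (∑Δ-∷ l w H) (∑Δ-+ w _ _)

  ∑Δ-comm : ∀ w H → ∑Δ w H ≈ ∑Δ w (λ u v → H v u)
  ∑Δ-comm []      H = refl
  ∑Δ-comm (l ∷ w) H = begin
    ∑Δ (l ∷ w) H                                        ≈⟨ ∑Δ-∷′ l w H ⟩
    ∑Δ w (λ u v → H (l ∷ u) v) + ∑Δ w (λ u v → H u (l ∷ v))
      ≈⟨ +-cong (∑Δ-comm w _) (∑Δ-comm w _) ⟩
    ∑Δ w (λ u v → H (l ∷ v) u) + ∑Δ w (λ u v → H v (l ∷ u)) ≈⟨ +-comm _ _ ⟩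
    _                                                   ≈⟨ ∑Δ-∷′ l w (λ u v → H v u) ⟨
    ∑Δ (l ∷ w) (λ u v → H v u)                          ∎

  ∑Δ-assoc : ∀ w (H : Word → Word → Word → Carrier) →
             ∑Δ w (λ u v → ∑Δ u λ p q → H p q v) ≈ ∑Δ w (λ p v → ∑Δ v λ q r → H p q r)
  ∑Δ-assoc []      H = refl
  ∑Δ-assoc (l ∷ w) H = begin
    ∑Δ (l ∷ w) (λ u v → ∑Δ u λ p q → H p q v)
      ≈⟨ ∑Δ-∷′ l w _ ⟩
    ∑Δ w (λ u v → ∑Δ (l ∷ u) λ p q → H p q v) + ∑Δ w (λ u v → ∑Δ u λ p q → H p q (l ∷ v))
      ≈⟨ +-congʳ (≈-trans (∑Δ-cong w (λ u v → ∑Δ-∷′ l u _)) (∑Δ-+ w _ _)) ⟩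
    (∑Δ w (λ u v → ∑Δ u λ p q → H (l ∷ p) q v) + ∑Δ w (λ u v → ∑Δ u λ p q → H p (l ∷ q) v))
      + ∑Δ w (λ u v → ∑Δ u λ p q → H p q (l ∷ v))
      ≈⟨ +-cong (+-cong (∑Δ-assoc w _) (∑Δ-assoc w _)) (∑Δ-assoc w _) ⟩
    (∑Δ w (λ p v → ∑Δ v λ q r → H (l ∷ p) q r) + ∑Δ w (λ p v → ∑Δ v λ q r → H p (l ∷ q) r))
      + ∑Δ w (λ p v → ∑Δ v λ q r → H p q (l ∷ r))
      ≈⟨ +-assoc _ _ _ ⟩
    _ ≈⟨ +-congˡ (≈-trans (∑Δ-cong w (λ p v → ∑Δ-∷′ l v _)) (∑Δ-+ w _ _)) ⟨
    ∑Δ w (λ p v → ∑Δ v λ q r → H (l ∷ p) q r) + ∑Δ w (λ p v → ∑Δ (l ∷ v) λ q r → H p q r)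
      ≈⟨ ∑Δ-∷′ l w _ ⟨
    ∑Δ (l ∷ w) (λ p v → ∑Δ v λ q r → H p q r) ∎

  -- Splitting twice sends each letter independently to one of four places, so the two middle places
  -- can be exchanged.
  ∑Δ-interchange : ∀ w (H : Word → Word → Word → Word → Carrier) →
                   ∑Δ w (λ u v → ∑Δ u λ p q → ∑Δ v λ r s → H p q r s) ≈
                   ∑Δ w (λ u v → ∑Δ u λ p r → ∑Δ v λ q s → H p q r s)
  ∑Δ-interchange []      H = refl
  ∑Δ-interchange (l ∷ w) H = begin
    ∑Δ (l ∷ w) (λ u v → ∑Δ u λ p q → ∑Δ v λ r s → H p q r s)
      ≈⟨ four H ⟩
    _ ≈⟨ +-cong (+-cong (∑Δ-interchange w _) (∑Δ-interchange w _))
                (+-cong (∑Δ-interchange w _) (∑Δ-interchange w _)) ⟩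
    -- The summand with l in the second place and the one with l in the third trade positions.
    _ ≈⟨ interchange _ _ _ _ ⟩
    _ ≈⟨ four (λ p r q s → H p q r s) ⟨
    ∑Δ (l ∷ w) (λ u v → ∑Δ u λ p r → ∑Δ v λ q s → H p q r s) ∎
    where
    four : ∀ (K : Word → Word → Word → Word → Carrier) →
           ∑Δ (l ∷ w) (λ u v → ∑Δ u λ p q → ∑Δ v λ r s → K p q r s) ≈
           (∑Δ w (λ u v → ∑Δ u λ p q → ∑Δ v λ r s → K (l ∷ p) q r s) +
            ∑Δ w (λ u v → ∑Δ u λ p q → ∑Δ v λ r s → K p (l ∷ q) r s)) +
           (∑Δ w (λ u v → ∑Δ u λ p q → ∑Δ v λ r s → K p q (l ∷ r) s) +
            ∑Δ w (λ u v → ∑Δ u λ p q → ∑Δ v λ r s → K p q r (l ∷ s)))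
    four K = ≈-trans (∑Δ-∷′ l w _) (+-cong
      (≈-trans (∑Δ-cong w (λ u v → ∑Δ-∷′ l u _)) (∑Δ-+ w _ _))
      (≈-trans (∑Δ-cong w (λ u v → ≈-trans (∑Δ-cong u (λ p q → ∑Δ-∷′ l v _)) (∑Δ-+ u _ _)))
               (∑Δ-+ w _ _)))

  ∑Δ-++ : ∀ w z (H : Word → Word → Carrier) →
          ∑Δ (w ++ z) H ≈ ∑Δ w λ u v → ∑Δ z λ x y → H (u ++ x) (v ++ y)
  ∑Δ-++ []      z H = ≈-sym (+-identityʳ _)
  ∑Δ-++ (l ∷ w) z H = begin
    ∑Δ (l ∷ w ++ z) H ≈⟨ ∑Δ-∷′ l (w ++ z) H ⟩
    _                 ≈⟨ +-cong (∑Δ-++ w z _) (∑Δ-++ w z _) ⟩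
    _                 ≈⟨ ∑Δ-∷′ l w _ ⟨
    ∑Δ (l ∷ w) (λ u v → ∑Δ z λ x y → H (u ++ x) (v ++ y)) ∎

  -- X_α under convolution and under Δ

  ∑X-∷ : ∀ a α w h →
         ∑ (X (a ∷ α) w) h ≈ ∑Δ w λ u v → (length u ≡ᵇ a) ▷ ∑ (X α v) λ p → h (u ++ p)
  ∑X-∷ a α w h = ≈-trans (∑-concatMap _ (deshuffles w) h) (∑Δ-cong w λ u v →
    ≈-trans (∑-if (length u ≡ᵇ a) (map (u ++_) (X α v)) h)
            (▷-cong (length u ≡ᵇ a) (reflexive (∑-map (u ++_) (X α v) h))))

  ∑X-[] : ∀ w h → ∑ (X [] w) h ≈ (length w ≡ᵇ 0) ▷ h w
  ∑X-[] []      h = +-identityʳ _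
  ∑X-[] (_ ∷ _) h = refl

  -- `X []` kills nonempty words and fixes the empty one, so it is the unit composed with the
  -- counit, and this is the counit axiom.
  ∑Δ-counitˡ : ∀ w (H : Word → Word → Carrier) →
               ∑Δ w (λ u v → ∑ (X [] u) λ p → H p v) ≈ H [] w
  ∑Δ-counitˡ []      H = ≈-trans (+-identityʳ _) (+-identityʳ _)
  ∑Δ-counitˡ (l ∷ w) H = begin
    ∑Δ (l ∷ w) (λ u v → ∑ (X [] u) λ p → H p v) ≈⟨ ∑Δ-∷ l w _ ⟩
    _ ≈⟨ ∑Δ-cong w (λ u v → +-identityˡ _) ⟩
    ∑Δ w (λ u v → ∑ (X [] u) λ p → H p (l ∷ v)) ≈⟨ ∑Δ-counitˡ w (λ p v → H p (l ∷ v)) ⟩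
    H [] (l ∷ w) ∎

  -- The induction on α is associativity of convolution, which comes from coassociativity of Δ.
  ∑X-++ : ∀ α β w h →
          ∑ (X (α ++ β) w) h ≈ ∑Δ w λ u v → ∑ (X α u) λ p → ∑ (X β v) λ q → h (p ++ q)
  ∑X-++ []      β w h = ≈-sym (∑Δ-counitˡ w (λ p v → ∑ (X β v) λ q → h (p ++ q)))
  ∑X-++ (a ∷ α) β w h = begin
    ∑ (X (a ∷ α ++ β) w) h
      ≈⟨ ∑X-∷ a (α ++ β) w h ⟩
    ∑Δ w (λ u v → (length u ≡ᵇ a) ▷ ∑ (X (α ++ β) v) λ p → h (u ++ p))
      ≈⟨ ∑Δ-cong w (λ u v → ≈-trans (▷-cong (length u ≡ᵇ a) (∑X-++ α β v _)) (▷-∑ (length u ≡ᵇ a) (deshuffles v) _)) ⟩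
    ∑Δ w (λ u v → ∑Δ v λ s t → (length u ≡ᵇ a) ▷ ∑ (X α s) λ p → ∑ (X β t) λ q → h (u ++ p ++ q))
      ≈⟨ ∑Δ-assoc w _ ⟨
    ∑Δ w (λ v t → ∑Δ v λ u s → (length u ≡ᵇ a) ▷ ∑ (X α s) λ p → ∑ (X β t) λ q → h (u ++ p ++ q))
      ≈⟨ ∑Δ-cong w (λ v t → ∑Δ-cong v λ u s → ▷-cong (length u ≡ᵇ a) (∑-cong (X α s) λ p →
           ∑-cong (X β t) λ q → reflexive (cong h (List.++-assoc u p q)))) ⟨
    ∑Δ w (λ v t → ∑Δ v λ u s → (length u ≡ᵇ a) ▷ ∑ (X α s) λ p → ∑ (X β t) λ q → h ((u ++ p) ++ q))
      ≈⟨ ∑Δ-cong w (λ v t → ∑X-∷ a α v _) ⟨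
    ∑Δ w (λ u v → ∑ (X (a ∷ α) u) λ p → ∑ (X β v) λ q → h (p ++ q)) ∎

  -- The pair (m , n) occurs once in `splitsℕ k` if m + n = k and never otherwise. This trades a
  -- condition on a total length for a sum over the ways to split it.
  ∑-splitsℕ : ∀ m n k x →
              ∑₂ (splitsℕ k) (λ k₁ k₂ → (m ≡ᵇ k₁) ▷ (n ≡ᵇ k₂) ▷ x) ≈ (m ℕ.+ n ≡ᵇ k) ▷ x
  ∑-splitsℕ zero    n zero    x = +-identityʳ _
  ∑-splitsℕ (suc m) n zero    x = +-identityʳ _
  ∑-splitsℕ zero    n (suc k) x =
    ≈-trans (+-congˡ (≈-trans (reflexive (∑-map (map₁ suc) (splitsℕ k) _)) (∑-zero (splitsℕ k))))
            (+-identityʳ _)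
  ∑-splitsℕ (suc m) n (suc k) x =
    ≈-trans (+-identityˡ _)
      (≈-trans (reflexive (∑-map (map₁ suc) (splitsℕ k) _)) (∑-splitsℕ m n k x))

  ∑-splits-∷ : ∀ a α (F : List ℕ → List ℕ → Carrier) →
               ∑₂ (splits (a ∷ α)) F ≈
               ∑₂ (splitsℕ a) λ a₁ a₂ → ∑₂ (splits α) λ α₁ α₂ → F (a₁ ∷ α₁) (a₂ ∷ α₂)
  ∑-splits-∷ a α F = ≈-trans (∑-concatMap _ (splitsℕ a) _)
    (∑₂-cong (splitsℕ a) λ a₁ a₂ → reflexive (∑-map _ (splits α) _))

  -- Δ is multiplicative, so the first block u and the remaining output p split separately, and the
  -- condition on the length of u becomes a sum over the splits of a. The four pieces are then
  -- regrouped so that each tensor factor receives its part of the first block and of the rest.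
  ∑X-Δ : ∀ α w (K : Word → Word → Carrier) →
         ∑ (X α w) (λ p → ∑Δ p K) ≈
         ∑₂ (splits α) λ α₁ α₂ → ∑Δ w λ u v → ∑ (X α₁ u) λ x → ∑ (X α₂ v) λ y → K x y
  ∑X-Δ []      w       K = begin
    ∑ (X [] w) (λ p → ∑Δ p K)   ≈⟨ unit w ⟩
    ∑ (X [] w) (λ y → K [] y)   ≈⟨ ∑Δ-counitˡ w (λ x v → ∑ (X [] v) λ y → K x y) ⟨
    ∑Δ w (λ u v → ∑ (X [] u) λ x → ∑ (X [] v) λ y → K x y) ≈⟨ +-identityʳ _ ⟨
    _ ∎
    where
    unit : ∀ w → ∑ (X [] w) (λ p → ∑Δ p K) ≈ ∑ (X [] w) (λ y → K [] y)
    unit []      = +-congʳ (+-identityʳ _)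
    unit (_ ∷ _) = refl
  ∑X-Δ (a ∷ α) w       K = begin
    ∑ (X (a ∷ α) w) (λ p → ∑Δ p K)
      ≈⟨ ∑X-∷ a α w _ ⟩
    ∑Δ w (λ u v → (length u ≡ᵇ a) ▷ ∑ (X α v) λ p → ∑Δ (u ++ p) K)
      ≈⟨ ∑Δ-cong w (λ u v → expand u v) ⟩
    ∑Δ w (λ u v → ∑₂ (splitsℕ a) λ a₁ a₂ → ∑₂ (splits α) λ α₁ α₂ → ∑Δ u λ s t → ∑Δ v λ p q → G a₁ a₂ α₁ α₂ s t p q)
      ≈⟨ ∑-swap (deshuffles w) (splitsℕ a) _ ⟩
    ∑₂ (splitsℕ a) (λ a₁ a₂ → ∑Δ w λ u v → ∑₂ (splits α) λ α₁ α₂ → ∑Δ u λ s t → ∑Δ v λ p q → G a₁ a₂ α₁ α₂ s t p q)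
      ≈⟨ ∑₂-cong (splitsℕ a) (λ a₁ a₂ → ∑-swap (deshuffles w) (splits α) _) ⟩
    ∑₂ (splitsℕ a) (λ a₁ a₂ → ∑₂ (splits α) λ α₁ α₂ → ∑Δ w λ u v → ∑Δ u λ s t → ∑Δ v λ p q → G a₁ a₂ α₁ α₂ s t p q)
      ≈⟨ ∑₂-cong (splitsℕ a) (λ a₁ a₂ → ∑₂-cong (splits α) λ α₁ α₂ → collect a₁ a₂ α₁ α₂) ⟩
    ∑₂ (splitsℕ a) (λ a₁ a₂ → ∑₂ (splits α) λ α₁ α₂ →
      ∑Δ w λ u v → ∑ (X (a₁ ∷ α₁) u) λ x → ∑ (X (a₂ ∷ α₂) v) λ y → K x y)
      ≈⟨ ∑-splits-∷ a α _ ⟨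
    _ ∎
    where
    G : ℕ → ℕ → List ℕ → List ℕ → Word → Word → Word → Word → Carrier
    G a₁ a₂ α₁ α₂ s t p q =
      (length s ≡ᵇ a₁) ▷ (length t ≡ᵇ a₂) ▷ ∑ (X α₁ p) λ x → ∑ (X α₂ q) λ y → K (s ++ x) (t ++ y)

    expand : ∀ u v → (length u ≡ᵇ a) ▷ ∑ (X α v) (λ p → ∑Δ (u ++ p) K) ≈
             ∑₂ (splitsℕ a) λ a₁ a₂ → ∑₂ (splits α) λ α₁ α₂ → ∑Δ u λ s t → ∑Δ v λ p q → G a₁ a₂ α₁ α₂ s t p q
    expand u v = begin
      (length u ≡ᵇ a) ▷ ∑ (X α v) (λ p → ∑Δ (u ++ p) K)
        ≈⟨ ▷-cong (length u ≡ᵇ a) (≈-trans (∑-cong (X α v) λ p → ∑Δ-++ u p K) (∑-swap (X α v) (deshuffles u) _)) ⟩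
      (length u ≡ᵇ a) ▷ ∑Δ u (λ s t → ∑ (X α v) λ p → ∑Δ p λ x y → K (s ++ x) (t ++ y))
        ≈⟨ ▷-cong (length u ≡ᵇ a) (∑Δ-cong u λ s t → ∑X-Δ α v _) ⟩
      (length u ≡ᵇ a) ▷ ∑Δ u (λ s t → Z s t)
        ≈⟨ ▷-∑ (length u ≡ᵇ a) (deshuffles u) _ ⟩
      ∑Δ u (λ s t → (length u ≡ᵇ a) ▷ Z s t)
        -- Only for the terms of Δ(u) do the two lengths add up to that of u, so membership is
        -- carried along.
        ≈⟨ ∑-cong-∈ (deshuffles u) (λ {(s , t)} st∈ → ≈-trans
             (reflexive (cong (λ n → (n ≡ᵇ a) ▷ Z s t) (deshuffles-length u st∈)))
             (≈-sym (∑-splitsℕ (length s) (length t) a (Z s t)))) ⟩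
      ∑Δ u (λ s t → ∑₂ (splitsℕ a) λ a₁ a₂ → (length s ≡ᵇ a₁) ▷ (length t ≡ᵇ a₂) ▷ Z s t)
        ≈⟨ ∑-swap (deshuffles u) (splitsℕ a) _ ⟩
      ∑₂ (splitsℕ a) (λ a₁ a₂ → ∑Δ u λ s t → (length s ≡ᵇ a₁) ▷ (length t ≡ᵇ a₂) ▷ Z s t)
        ≈⟨ ∑₂-cong (splitsℕ a) (λ a₁ a₂ → ∑Δ-cong u λ s t → distribute (length s ≡ᵇ a₁) (length t ≡ᵇ a₂) s t) ⟩
      ∑₂ (splitsℕ a) (λ a₁ a₂ → ∑Δ u λ s t → ∑₂ (splits α) λ α₁ α₂ → ∑Δ v λ p q → G a₁ a₂ α₁ α₂ s t p q)
        ≈⟨ ∑₂-cong (splitsℕ a) (λ a₁ a₂ → ∑-swap (deshuffles u) (splits α) _) ⟩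
      ∑₂ (splitsℕ a) (λ a₁ a₂ → ∑₂ (splits α) λ α₁ α₂ → ∑Δ u λ s t → ∑Δ v λ p q → G a₁ a₂ α₁ α₂ s t p q) ∎
      where
      Y : Word → Word → List ℕ → List ℕ → Word → Word → Carrier
      Y s t α₁ α₂ p q = ∑ (X α₁ p) λ x → ∑ (X α₂ q) λ y → K (s ++ x) (t ++ y)

      Z : Word → Word → Carrier
      Z s t = ∑₂ (splits α) λ α₁ α₂ → ∑Δ v (Y s t α₁ α₂)

      distribute : ∀ b₁ b₂ s t → b₁ ▷ b₂ ▷ Z s t ≈
                   ∑₂ (splits α) λ α₁ α₂ → ∑Δ v λ p q → b₁ ▷ b₂ ▷ Y s t α₁ α₂ p q
      distribute true  true  s t = refl
      distribute true  false s t = ≈-sym (≈-trans (∑-cong (splits α) (λ _ → ∑-zero (deshuffles v))) (∑-zero (splits α)))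
      distribute false _     s t = ≈-sym (≈-trans (∑-cong (splits α) (λ _ → ∑-zero (deshuffles v))) (∑-zero (splits α)))

    collect : ∀ a₁ a₂ α₁ α₂ →
              ∑Δ w (λ u v → ∑Δ u λ s t → ∑Δ v λ p q → G a₁ a₂ α₁ α₂ s t p q) ≈
              ∑Δ w λ u v → ∑ (X (a₁ ∷ α₁) u) λ x → ∑ (X (a₂ ∷ α₂) v) λ y → K x y
    collect a₁ a₂ α₁ α₂ = begin
      ∑Δ w (λ u v → ∑Δ u λ s t → ∑Δ v λ p q → G a₁ a₂ α₁ α₂ s t p q)
        ≈⟨ ∑Δ-interchange w _ ⟩
      ∑Δ w (λ u v → ∑Δ u λ s p → ∑Δ v λ t q → G a₁ a₂ α₁ α₂ s t p q)
        ≈⟨ ∑Δ-cong w (λ u v → ∑Δ-cong u λ s p → pull u v s p) ⟩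
      ∑Δ w (λ u v → ∑Δ u λ s p → (length s ≡ᵇ a₁) ▷ ∑ (X α₁ p) λ x → ∑ (X (a₂ ∷ α₂) v) λ y → K (s ++ x) y)
        ≈⟨ ∑Δ-cong w (λ u v → ∑X-∷ a₁ α₁ u _) ⟨
      ∑Δ w (λ u v → ∑ (X (a₁ ∷ α₁) u) λ x → ∑ (X (a₂ ∷ α₂) v) λ y → K x y) ∎
      where
      pull : ∀ u v s p → ∑Δ v (λ t q → G a₁ a₂ α₁ α₂ s t p q) ≈
             (length s ≡ᵇ a₁) ▷ ∑ (X α₁ p) λ x → ∑ (X (a₂ ∷ α₂) v) λ y → K (s ++ x) y
      pull u v s p = begin
        ∑Δ v (λ t q → (length s ≡ᵇ a₁) ▷ (length t ≡ᵇ a₂) ▷ ∑ (X α₁ p) λ x → ∑ (X α₂ q) λ y → K (s ++ x) (t ++ y))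
          ≈⟨ ▷-∑ (length s ≡ᵇ a₁) (deshuffles v) _ ⟨
        (length s ≡ᵇ a₁) ▷ ∑Δ v (λ t q → (length t ≡ᵇ a₂) ▷ ∑ (X α₁ p) λ x → ∑ (X α₂ q) λ y → K (s ++ x) (t ++ y))
          ≈⟨ ▷-cong (length s ≡ᵇ a₁) (begin
            ∑Δ v (λ t q → (length t ≡ᵇ a₂) ▷ ∑ (X α₁ p) λ x → ∑ (X α₂ q) λ y → K (s ++ x) (t ++ y))
              ≈⟨ ∑Δ-cong v (λ t q → ▷-∑ (length t ≡ᵇ a₂) (X α₁ p) _) ⟩
            ∑Δ v (λ t q → ∑ (X α₁ p) λ x → (length t ≡ᵇ a₂) ▷ ∑ (X α₂ q) λ y → K (s ++ x) (t ++ y))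
              ≈⟨ ∑-swap (deshuffles v) (X α₁ p) _ ⟩
            ∑ (X α₁ p) (λ x → ∑Δ v λ t q → (length t ≡ᵇ a₂) ▷ ∑ (X α₂ q) λ y → K (s ++ x) (t ++ y))
              ≈⟨ ∑-cong (X α₁ p) (λ x → ∑X-∷ a₂ α₂ v _) ⟨
            ∑ (X α₁ p) (λ x → ∑ (X (a₂ ∷ α₂) v) λ y → K (s ++ x) y) ∎) ⟩
        (length s ≡ᵇ a₁) ▷ ∑ (X α₁ p) (λ x → ∑ (X (a₂ ∷ α₂) v) λ y → K (s ++ x) y) ∎

  -- The product formula for X_α # X_β

  ∑-heads : ∀ b α w h →
            ∑ (heads b α) (λ γ → ∑ (X γ w) h) ≈
            ∑Δ w λ u v → ∑ (X α v) λ x → (length (u ++ x) ≡ᵇ b) ▷ h (u ++ x)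
  ∑-heads b α w h = begin
    ∑ (heads b α) (λ γ → ∑ (X γ w) h)
      ≈⟨ ∑-concatMap _ (splitsℕ b) _ ⟩
    _ ≈⟨ ∑₂-cong (splitsℕ b) (λ b₁ b₂ → term b₁ b₂ ) ⟩
    ∑₂ (splitsℕ b) (λ b₁ b₂ → ∑Δ w λ u v → ∑ (X α v) λ x → (length u ≡ᵇ b₁) ▷ (sum α ≡ᵇ b₂) ▷ h (u ++ x))
      ≈⟨ ∑-swap (splitsℕ b) (deshuffles w) _ ⟩
    ∑Δ w (λ u v → ∑₂ (splitsℕ b) λ b₁ b₂ → ∑ (X α v) λ x → (length u ≡ᵇ b₁) ▷ (sum α ≡ᵇ b₂) ▷ h (u ++ x))
      ≈⟨ ∑Δ-cong w (λ u v → ∑-swap (splitsℕ b) (X α v) _) ⟩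
    ∑Δ w (λ u v → ∑ (X α v) λ x → ∑₂ (splitsℕ b) λ b₁ b₂ → (length u ≡ᵇ b₁) ▷ (sum α ≡ᵇ b₂) ▷ h (u ++ x))
      -- All words of X_α have length `sum α`, so a condition on the index alone becomes one on the
      -- degree of u x.
      ≈⟨ ∑Δ-cong w (λ u v → ∑-cong-∈ (X α v) λ {x} x∈ → ≈-trans
           (∑-splitsℕ (length u) (sum α) b (h (u ++ x)))
           (reflexive (cong (λ n → (n ≡ᵇ b) ▷ h (u ++ x)) (length-++-X u x∈)))) ⟩
    ∑Δ w (λ u v → ∑ (X α v) λ x → (length (u ++ x) ≡ᵇ b) ▷ h (u ++ x)) ∎
    where
    length-++-X : ∀ {v} u {x} → x ∈ X α v → length u ℕ.+ sum α ≡ length (u ++ x)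
    length-++-X {v} u {x} x∈ =
      ≡.trans (cong (length u ℕ.+_) (≡.sym (X-length α v x∈))) (≡.sym (List.length-++ u))

    term : ∀ b₁ b₂ → ∑ (if sum α ≡ᵇ b₂ then (b₁ ∷ α) ∷ [] else []) (λ γ → ∑ (X γ w) h) ≈
           ∑Δ w λ u v → ∑ (X α v) λ x → (length u ≡ᵇ b₁) ▷ (sum α ≡ᵇ b₂) ▷ h (u ++ x)
    term b₁ b₂ = begin
      ∑ (if sum α ≡ᵇ b₂ then (b₁ ∷ α) ∷ [] else []) (λ γ → ∑ (X γ w) h)
        ≈⟨ ∑-if (sum α ≡ᵇ b₂) _ _ ⟩
      (sum α ≡ᵇ b₂) ▷ (∑ (X (b₁ ∷ α) w) h + 0#)
        ≈⟨ ▷-cong (sum α ≡ᵇ b₂) (≈-trans (+-identityʳ _) (∑X-∷ b₁ α w h)) ⟩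
      (sum α ≡ᵇ b₂) ▷ ∑Δ w (λ u v → (length u ≡ᵇ b₁) ▷ ∑ (X α v) λ x → h (u ++ x))
        ≈⟨ ▷-∑ (sum α ≡ᵇ b₂) (deshuffles w) _ ⟩
      ∑Δ w (λ u v → (sum α ≡ᵇ b₂) ▷ (length u ≡ᵇ b₁) ▷ ∑ (X α v) λ x → h (u ++ x))
        ≈⟨ ∑Δ-cong w (λ u v → ≈-trans (▷-comm (sum α ≡ᵇ b₂) (length u ≡ᵇ b₁) _)
             (≈-trans (▷-cong (length u ≡ᵇ b₁) (▷-∑ (sum α ≡ᵇ b₂) (X α v) _)) (▷-∑ (length u ≡ᵇ b₁) (X α v) _))) ⟩
      ∑Δ w (λ u v → ∑ (X α v) λ x → (length u ≡ᵇ b₁) ▷ (sum α ≡ᵇ b₂) ▷ h (u ++ x)) ∎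

  -- The first block of X_β takes p from u and x from the output z of X_α, leaving q and y. By
  -- `∑X-Δ`, x and y come from X_α₁ and X_α₂. The pair (p, x) is what `heads` describes, and (q, y)
  -- poses the same problem for α₂ and the shorter β.
  ∑-absorb : ∀ α β w h →
             ∑ (absorb α β) (λ γ → ∑ (X γ w) h) ≈
             ∑Δ w λ u v → ∑ (X α v) λ x → ∑ (X β (u ++ x)) h
  ∑-absorb α []      w h = begin
    ∑ (heads 0 α) (λ γ → ∑ (X γ w) h) ≈⟨ ∑-heads 0 α w h ⟩
    _ ≈⟨ ∑Δ-cong w (λ u v → ∑-cong (X α v) λ x → ∑X-[] (u ++ x) h) ⟨
    ∑Δ w (λ u v → ∑ (X α v) λ x → ∑ (X [] (u ++ x)) h) ∎
  ∑-absorb α (b ∷ β) w h = begin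
    ∑ (absorb α (b ∷ β)) (λ γ → ∑ (X γ w) h)
      ≈⟨ ≈-trans (∑-concatMap _ (splits α) _) (∑₂-cong (splits α) λ α₁ α₂ →
           ≈-trans (∑-concatMap _ (heads b α₁) _) (∑-cong (heads b α₁) λ γ →
             reflexive (∑-map (γ ++_) (absorb α₂ β) _))) ⟩
    ∑₂ (splits α) (λ α₁ α₂ → ∑ (heads b α₁) λ γ → ∑ (absorb α₂ β) λ δ → ∑ (X (γ ++ δ) w) h)
      ≈⟨ ∑₂-cong (splits α) (λ α₁ α₂ → factor α₁ α₂) ⟩
    ∑₂ (splits α) (λ α₁ α₂ → ∑Δ w λ u v → ∑Δ u λ p q → ∑Δ v λ s t →
      ∑ (X α₁ s) λ x → ∑ (X α₂ t) λ y → body p q x y)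
      ≈⟨ ∑-swap (splits α) (deshuffles w) _ ⟩
    ∑Δ w (λ u v → ∑₂ (splits α) λ α₁ α₂ → ∑Δ u λ p q → ∑Δ v λ s t →
      ∑ (X α₁ s) λ x → ∑ (X α₂ t) λ y → body p q x y)
      ≈⟨ ∑Δ-cong w (λ u v → ∑-swap (splits α) (deshuffles u) _) ⟩
    ∑Δ w (λ u v → ∑Δ u λ p q → ∑₂ (splits α) λ α₁ α₂ → ∑Δ v λ s t →
      ∑ (X α₁ s) λ x → ∑ (X α₂ t) λ y → body p q x y)
      ≈⟨ ∑Δ-cong w (λ u v → ∑Δ-cong u λ p q → ∑X-Δ α v (body p q)) ⟨
    ∑Δ w (λ u v → ∑Δ u λ p q → ∑ (X α v) λ z → ∑Δ z λ x y → body p q x y)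
      ≈⟨ ∑Δ-cong w (λ u v → ∑-swap (deshuffles u) (X α v) _) ⟩
    ∑Δ w (λ u v → ∑ (X α v) λ z → ∑Δ u λ p q → ∑Δ z λ x y → body p q x y)
      ≈⟨ ∑Δ-cong w (λ u v → ∑-cong (X α v) λ z → ≈-trans (∑X-∷ b β (u ++ z) h) (∑Δ-++ u z _)) ⟨
    ∑Δ w (λ u v → ∑ (X α v) λ z → ∑ (X (b ∷ β) (u ++ z)) h) ∎
    where
    body : Word → Word → Word → Word → Carrier
    body p q x y = (length (p ++ x) ≡ᵇ b) ▷ ∑ (X β (q ++ y)) λ r → h ((p ++ x) ++ r)

    factor : ∀ α₁ α₂ →
      ∑ (heads b α₁) (λ γ → ∑ (absorb α₂ β) λ δ → ∑ (X (γ ++ δ) w) h) ≈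
      ∑Δ w λ u v → ∑Δ u λ p q → ∑Δ v λ s t → ∑ (X α₁ s) λ x → ∑ (X α₂ t) λ y → body p q x y
    factor α₁ α₂ = begin
      ∑ (heads b α₁) (λ γ → ∑ (absorb α₂ β) λ δ → ∑ (X (γ ++ δ) w) h)
        ≈⟨ ∑-cong (heads b α₁) (λ γ → ≈-trans (∑-cong (absorb α₂ β) λ δ → ∑X-++ γ δ w h)
             (≈-trans (∑-swap (absorb α₂ β) (deshuffles w) _)
               (∑Δ-cong w λ u v → ∑-swap (absorb α₂ β) (X γ u) _))) ⟩
      ∑ (heads b α₁) (λ γ → ∑Δ w λ u v → ∑ (X γ u) λ r → ∑ (absorb α₂ β) λ δ → ∑ (X δ v) λ r′ → h (r ++ r′))
        ≈⟨ ∑-swap (heads b α₁) (deshuffles w) _ ⟩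
      ∑Δ w (λ u v → ∑ (heads b α₁) λ γ → ∑ (X γ u) λ r → ∑ (absorb α₂ β) λ δ → ∑ (X δ v) λ r′ → h (r ++ r′))
        ≈⟨ ∑Δ-cong w (λ u v → ∑-cong (heads b α₁) λ γ → ∑-cong (X γ u) λ r → ∑-absorb α₂ β v _) ⟩
      ∑Δ w (λ u v → ∑ (heads b α₁) λ γ → ∑ (X γ u) λ r → tail v r)
        ≈⟨ ∑Δ-cong w (λ u v → ∑-heads b α₁ u _) ⟩
      ∑Δ w (λ u v → ∑Δ u λ p s → ∑ (X α₁ s) λ x → (length (p ++ x) ≡ᵇ b) ▷ tail v (p ++ x))
        ≈⟨ ∑Δ-cong w (λ u v → ∑Δ-cong u λ p s → ≈-trans
             (∑-cong (X α₁ s) λ x → ≈-trans (▷-∑ (length (p ++ x) ≡ᵇ b) (deshuffles v) _)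
               (∑Δ-cong v λ q t → ▷-∑ (length (p ++ x) ≡ᵇ b) (X α₂ t) _))
             (∑-swap (X α₁ s) (deshuffles v) _)) ⟩
      ∑Δ w (λ u v → ∑Δ u λ p s → ∑Δ v λ q t → ∑ (X α₁ s) λ x → ∑ (X α₂ t) λ y → body p q x y)
        -- From grouping by destination, first block against later ones, to grouping by origin: p
        -- and q are the letters that X_α does not receive, s and t those that it does.
        ≈⟨ ∑Δ-interchange w _ ⟩
      ∑Δ w (λ u v → ∑Δ u λ p q → ∑Δ v λ s t → ∑ (X α₁ s) λ x → ∑ (X α₂ t) λ y → body p q x y) ∎
      where
      tail : Word → Word → Carrier
      tail v r = ∑Δ v λ q t → ∑ (X α₂ t) λ y → ∑ (X β (q ++ y)) λ r′ → h (r ++ r′)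

  -- The right side is X_α # X_β: the cyclic shift puts y in front and leaves v x as the argument of
  -- X_β. Splitting α along Δ ∘ X_α lets y contribute the leading parts α₂, while `absorb` accounts
  -- for X_β(v x).
  ∑-smash : ∀ α β w h →
            ∑ (smash α β) (λ γ → ∑ (X γ w) h) ≈
            ∑Δ w λ u v → ∑ (X α u) λ p → ∑Δ p λ x y → ∑ (X β (v ++ x)) λ q → h (y ++ q)
  ∑-smash α β w h = begin
    ∑ (smash α β) (λ γ → ∑ (X γ w) h)
      ≈⟨ ≈-trans (∑-concatMap _ (splits α) _) (∑₂-cong (splits α) λ α₁ α₂ →
           reflexive (∑-map (α₂ ++_) (absorb α₁ β) _)) ⟩
    ∑₂ (splits α) (λ α₁ α₂ → ∑ (absorb α₁ β) λ γ → ∑ (X (α₂ ++ γ) w) h)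
      ≈⟨ ∑₂-cong (splits α) (λ α₁ α₂ → reorder α₁ α₂) ⟩
    ∑₂ (splits α) (λ α₁ α₂ → ∑Δ w λ u v → ∑Δ u λ s t → ∑ (X α₁ s) λ x → ∑ (X α₂ t) λ y →
      ∑ (X β (v ++ x)) λ q → h (y ++ q))
      ≈⟨ ∑-swap (splits α) (deshuffles w) _ ⟩
    ∑Δ w (λ u v → ∑₂ (splits α) λ α₁ α₂ → ∑Δ u λ s t → ∑ (X α₁ s) λ x → ∑ (X α₂ t) λ y →
      ∑ (X β (v ++ x)) λ q → h (y ++ q))
      ≈⟨ ∑Δ-cong w (λ u v → ∑X-Δ α u _) ⟨
    ∑Δ w (λ u v → ∑ (X α u) λ p → ∑Δ p λ x y → ∑ (X β (v ++ x)) λ q → h (y ++ q)) ∎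
    where
    reorder : ∀ α₁ α₂ →
      ∑ (absorb α₁ β) (λ γ → ∑ (X (α₂ ++ γ) w) h) ≈
      ∑Δ w λ u v → ∑Δ u λ s t → ∑ (X α₁ s) λ x → ∑ (X α₂ t) λ y → ∑ (X β (v ++ x)) λ q → h (y ++ q)
    reorder α₁ α₂ = begin
      ∑ (absorb α₁ β) (λ γ → ∑ (X (α₂ ++ γ) w) h)
        ≈⟨ ∑-cong (absorb α₁ β) (λ γ → ∑X-++ α₂ γ w h) ⟩
      ∑ (absorb α₁ β) (λ γ → ∑Δ w λ t z → ∑ (X α₂ t) λ y → ∑ (X γ z) λ q → h (y ++ q))
        ≈⟨ ∑-swap (absorb α₁ β) (deshuffles w) _ ⟩
      ∑Δ w (λ t z → ∑ (absorb α₁ β) λ γ → ∑ (X α₂ t) λ y → ∑ (X γ z) λ q → h (y ++ q))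
        ≈⟨ ∑Δ-cong w (λ t z → ∑-swap (absorb α₁ β) (X α₂ t) _) ⟩
      ∑Δ w (λ t z → ∑ (X α₂ t) λ y → ∑ (absorb α₁ β) λ γ → ∑ (X γ z) λ q → h (y ++ q))
        ≈⟨ ∑Δ-cong w (λ t z → ∑-cong (X α₂ t) λ y → ≈-trans (∑-absorb α₁ β z _) (∑Δ-comm z _)) ⟩
      ∑Δ w (λ t z → ∑ (X α₂ t) λ y → ∑Δ z λ s v → ∑ (X α₁ s) λ x → ∑ (X β (v ++ x)) λ q → h (y ++ q))
        ≈⟨ ∑Δ-cong w (λ t z → ≈-trans (∑-swap (X α₂ t) (deshuffles z) _)
             (∑Δ-cong z λ s v → ∑-swap (X α₂ t) (X α₁ s) _)) ⟩
      ∑Δ w (λ t z → ∑Δ z λ s v → ∑ (X α₁ s) λ x → ∑ (X α₂ t) λ y → ∑ (X β (v ++ x)) λ q → h (y ++ q))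
        ≈⟨ ∑Δ-assoc w _ ⟨
      ∑Δ w (λ u v → ∑Δ u λ t s → ∑ (X α₁ s) λ x → ∑ (X α₂ t) λ y → ∑ (X β (v ++ x)) λ q → h (y ++ q))
        ≈⟨ ∑Δ-cong w (λ u v → ∑Δ-comm u _) ⟩
      ∑Δ w (λ u v → ∑Δ u λ s t → ∑ (X α₁ s) λ x → ∑ (X α₂ t) λ y → ∑ (X β (v ++ x)) λ q → h (y ++ q)) ∎

  -- Endomorphisms paired with functionals

  *-▷ : ∀ r p x → r * (p ▷ x) ≈ p ▷ r * x
  *-▷ r true  x = refl
  *-▷ r false x = zeroʳ r

  ▷-* : ∀ p r x → (p ▷ r) * x ≈ p ▷ r * x
  ▷-* true  r x = refl
  ▷-* false r x = zeroˡ x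

  ∑-distribʳ : (xs : List A) (f : A → Carrier) (r : Carrier) → ∑ xs (λ x → f x * r) ≈ ∑ xs f * r
  ∑-distribʳ []       f r = ≈-sym (zeroˡ r)
  ∑-distribʳ (x ∷ xs) f r = ≈-trans (+-congˡ (∑-distribʳ xs f r)) (≈-sym (distribʳ r _ _))

  ∑-unique : {xs : List A} {f : A → Carrier} {x : A} → Unique xs → x ∈ xs →
             (∀ {y} → y ∈ xs → y ≢ x → f y ≈ 0#) → ∑ xs f ≈ f x
  ∑-unique {xs = x ∷ xs} (x∉ ∷ _) (here ≡.refl) vanish = ≈-trans
    (+-congˡ (≈-trans (∑-cong-∈ xs λ y∈ → vanish (there y∈) (≡.≢-sym (All.lookup x∉ y∈))) (∑-zero xs)))
    (+-identityʳ _)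
  ∑-unique {xs = z ∷ xs} (z∉ ∷ xs!) (there x∈) vanish = ≈-trans
    (+-cong (vanish (here ≡.refl) (All.lookup z∉ x∈)) (∑-unique xs! x∈ (vanish ∘ there)))
    (+-identityˡ _)

  ∑-* : (xs : List A) (G : List (Carrier × B)) (F : A → B → Carrier) →
        ∑ xs (λ x → ∑₂ G λ r y → r * F x y) ≈ ∑₂ G λ r y → r * ∑ xs λ x → F x y
  ∑-* xs G F = ≈-trans (∑-swap xs G _) (∑₂-cong G λ r y → ∑-distribˡ xs r _)

  -- Formal combinations may repeat words and contain zero terms, so elements of T(V) are compared
  -- through their pairings with functions on words.
  ⟪_⟫ : T1 → (Word → Carrier) → Carrier
  ⟪ t ⟫ h = ∑₂ t λ r u → r * h u

  ⟪⟫-cong : ∀ t {h k : Word → Carrier} → (∀ u → h u ≈ k u) → ⟪ t ⟫ h ≈ ⟪ t ⟫ k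
  ⟪⟫-cong t h≈k = ∑₂-cong t λ r u → *-congˡ (h≈k u)

  ⟪_⟫₂ : T2 → (Word → Word → Carrier) → Carrier
  ⟪ t ⟫₂ H = ∑ t λ (r , u , v) → r * H u v

  ⟪_⟫₃ : T3 → (Word → Word → Word → Carrier) → Carrier
  ⟪ t ⟫₃ H = ∑ t λ (r , u , v , w) → r * H u v w

  ⟪⟫₂-cong : ∀ t {H K : Word → Word → Carrier} → (∀ u v → H u v ≈ K u v) → ⟪ t ⟫₂ H ≈ ⟪ t ⟫₂ K
  ⟪⟫₂-cong t H≈K = ∑-cong t λ (r , u , v) → *-congˡ (H≈K u v)

  ⟪Δ⟫ : ∀ w H → ⟪ Δ w ⟫₂ H ≈ ∑Δ w H
  ⟪Δ⟫ []      H = +-congʳ (*-identityˡ _)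
  ⟪Δ⟫ (l ∷ w) H = begin
    ⟪ Δ (l ∷ w) ⟫₂ H
      ≈⟨ ∑-concatMap _ (Δ w) _ ⟩
    _ ≈⟨ ∑-cong (Δ w) (λ (r , u , v) → ≈-trans (+-congˡ (+-identityʳ _)) (≈-sym (distribˡ r _ _))) ⟩
    ⟪ Δ w ⟫₂ (λ u v → H (l ∷ u) v + H u (l ∷ v))
      ≈⟨ ⟪Δ⟫ w _ ⟩
    _ ≈⟨ ∑Δ-∷ l w H ⟨
    ∑Δ (l ∷ w) H ∎

  ∑-scale : (r : Carrier) (t : List (Carrier × A)) (f : A → Carrier) →
            ∑₂ t (λ s x → (r * s) * f x) ≈ r * ∑₂ t (λ s x → s * f x)
  ∑-scale r t f = ≈-trans (∑₂-cong t λ s x → *-assoc r s (f x)) (∑-distribˡ t r _)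

  ⟪f⊗1⟫ : ∀ f t H → ⟪ f⊗1 f t ⟫₂ H ≈ ⟪ t ⟫₂ λ u v → ⟪ f u ⟫ λ p → H p v
  ⟪f⊗1⟫ f t H = ≈-trans (∑-concatMap _ t _) (∑-cong t λ (r , u , v) →
    ≈-trans (reflexive (∑-map _ (f u) _)) (∑-scale r (f u) λ p → H p v))

  ⟪1⊗g⟫ : ∀ g t H → ⟪ 1⊗g g t ⟫₂ H ≈ ⟪ t ⟫₂ λ u v → ⟪ g v ⟫ λ q → H u q
  ⟪1⊗g⟫ g t H = ≈-trans (∑-concatMap _ t _) (∑-cong t λ (r , u , v) →
    ≈-trans (reflexive (∑-map _ (g v) _)) (∑-scale r (g v) λ q → H u q))

  ⟪Δ⊗1⟫ : ∀ t H → ⟪ Δ⊗1 t ⟫₃ H ≈ ⟪ t ⟫₂ λ u v → ∑Δ u λ x y → H x y v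
  ⟪Δ⊗1⟫ t H = ≈-trans (∑-concatMap _ t _) (∑-cong t λ (r , u , v) →
    ≈-trans (reflexive (∑-map _ (Δ u) _))
      (≈-trans (∑-scale r (Δ u) λ (x , y) → H x y v) (*-congˡ (⟪Δ⟫ u λ x y → H x y v))))

  ⟪#⟫ : ∀ f g w h → ⟪ (f # g) w ⟫ h ≈
        ∑Δ w λ u v → ⟪ f u ⟫ λ p → ∑Δ p λ x y → ⟪ g (v ++ x) ⟫ λ q → h (y ++ q)
  ⟪#⟫ f g w h = begin
    ⟪ (f # g) w ⟫ h
      ≡⟨ ∑-map _ (1⊗g g (1⊗m (cyclic (Δ⊗1 (f⊗1 f (Δ w)))))) _ ⟩
    ⟪ 1⊗g g (1⊗m (cyclic (Δ⊗1 (f⊗1 f (Δ w))))) ⟫₂ (λ y q → h (y ++ q))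
      ≈⟨ ⟪1⊗g⟫ g (1⊗m (cyclic (Δ⊗1 (f⊗1 f (Δ w))))) _ ⟩
    ⟪ 1⊗m (cyclic (Δ⊗1 (f⊗1 f (Δ w)))) ⟫₂ (λ y s → ⟪ g s ⟫ λ q → h (y ++ q))
      ≡⟨ ≡.trans (∑-map _ (cyclic (Δ⊗1 (f⊗1 f (Δ w)))) _) (∑-map _ (Δ⊗1 (f⊗1 f (Δ w))) _) ⟩
    ⟪ Δ⊗1 (f⊗1 f (Δ w)) ⟫₃ (λ x y v → ⟪ g (v ++ x) ⟫ λ q → h (y ++ q))
      ≈⟨ ⟪Δ⊗1⟫ (f⊗1 f (Δ w)) _ ⟩
    ⟪ f⊗1 f (Δ w) ⟫₂ (λ p v → ∑Δ p λ x y → ⟪ g (v ++ x) ⟫ λ q → h (y ++ q))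
      ≈⟨ ⟪f⊗1⟫ f (Δ w) _ ⟩
    ⟪ Δ w ⟫₂ (λ u v → ⟪ f u ⟫ λ p → ∑Δ p λ x y → ⟪ g (v ++ x) ⟫ λ q → h (y ++ q))
      ≈⟨ ⟪Δ⟫ w _ ⟩
    ∑Δ w (λ u v → ⟪ f u ⟫ λ p → ∑Δ p λ x y → ⟪ g (v ++ x) ⟫ λ q → h (y ++ q)) ∎

  -- In contrast to `InΣ`, this controls f on every word and uses one finite list for all degrees,
  -- as the evaluation of a smash product requires.
  XSpan : End → Set _
  XSpan f = ∃ λ (G : List (Carrier × List ℕ)) →
            ∀ w h → ⟪ f w ⟫ h ≈ ∑₂ G λ r α → r * ∑ (X α w) h

  -- Bilinearity reduces this to `∑-smash`. As h is arbitrary in `XSpan`, the expansion of f may be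
  -- applied to a functional that already contains g.
  XSpan-# : ∀ f g → XSpan f → XSpan g → XSpan (f # g)
  XSpan-# f g (F , f≈) (G , g≈) =
    concatMap (λ (r , α) → concatMap (λ (s , β) → map (λ γ → r * s , γ) (smash α β)) G) F , λ w h → begin
    ⟪ (f # g) w ⟫ h
      ≈⟨ ⟪#⟫ f g w h ⟩
    ∑Δ w (λ u v → ⟪ f u ⟫ λ p → ∑Δ p λ x y → ⟪ g (v ++ x) ⟫ λ q → h (y ++ q))
      ≈⟨ ∑Δ-cong w (λ u v → ≈-trans (⟪⟫-cong (f u) λ p → ≈-trans (∑Δ-cong p λ x y → g≈ (v ++ x) _) (∑-* (deshuffles p) G _))
           (f≈ u _)) ⟩
    ∑Δ w (λ u v → ∑₂ F λ r α → r * ∑ (X α u) λ p → ∑₂ G λ s β → s * ∑Δ p λ x y → ∑ (X β (v ++ x)) λ q → h (y ++ q))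
      ≈⟨ ∑-* (deshuffles w) F _ ⟩
    ∑₂ F (λ r α → r * ∑Δ w λ u v → ∑ (X α u) λ p → ∑₂ G λ s β → s * ∑Δ p λ x y → ∑ (X β (v ++ x)) λ q → h (y ++ q))
      ≈⟨ ∑₂-cong F (λ r α → *-congˡ (≈-trans (∑Δ-cong w λ u v → ∑-* (X α u) G _) (∑-* (deshuffles w) G _))) ⟩
    ∑₂ F (λ r α → r * ∑₂ G λ s β → s * ∑Δ w λ u v → ∑ (X α u) λ p → ∑Δ p λ x y → ∑ (X β (v ++ x)) λ q → h (y ++ q))
      ≈⟨ ∑₂-cong F (λ r α → *-congˡ (∑₂-cong G λ s β → *-congˡ (∑-smash α β w h))) ⟨
    ∑₂ F (λ r α → r * ∑₂ G λ s β → s * ∑ (smash α β) λ γ → ∑ (X γ w) h)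
      ≈⟨ ∑₂-cong F (λ r α → ∑-scale r G _) ⟨
    ∑₂ F (λ r α → ∑₂ G λ s β → (r * s) * ∑ (smash α β) λ γ → ∑ (X γ w) h)
      ≈⟨ ∑₂-cong F (λ r α → ∑₂-cong G λ s β → ≈-trans (reflexive (∑-map _ (smash α β) _)) (∑-distribˡ (smash α β) (r * s) _)) ⟨
    ∑₂ F (λ r α → ∑₂ G λ s β → ∑₂ (map (λ γ → r * s , γ) (smash α β)) λ r γ → r * ∑ (X γ w) h)
      ≈⟨ ∑₂-cong F (λ r α → ∑-concatMap _ G _) ⟨
    _ ≈⟨ ∑-concatMap _ F _ ⟨
    _ ∎

  -- The coefficient of a permutation in X_γ

  _=ʷ_ : Word → Word → Bool
  s =ʷ u = does (List.≡-dec ℕ._≟_ s u)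

  δ : Word → Word → Carrier
  δ s u = (s =ʷ u) ▷ 1#

  coeff≈⟪⟫δ : ∀ s t → coeff s t ≈ ⟪ t ⟫ (δ s)
  coeff≈⟪⟫δ s [] = refl
  coeff≈⟪⟫δ s ((r , u) ∷ t) with List.≡-dec ℕ._≟_ s u
  ... | yes _ = +-cong (≈-sym (*-identityʳ r)) (coeff≈⟪⟫δ s t)
  ... | no _  = ≈-trans (coeff≈⟪⟫δ s t) (≈-sym (≈-trans (+-congʳ (zeroʳ r)) (+-identityˡ _)))

  -- In a word without repeated letters p occurs at most once as a subword, so the sum
  -- over Δ(w) has at most one term, taken at the complement of p.
  ∑-cut : Word → Word → (Word → Carrier) → Carrier
  ∑-cut p w H = ∑Δ w λ u v → (p =ʷ u) ▷ H v

  ∑-cut-[]-∷ : ∀ l w H → ∑-cut [] (l ∷ w) H ≈ ∑-cut [] w (λ v → H (l ∷ v))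
  ∑-cut-[]-∷ l w H = ≈-trans (∑Δ-∷ l w _) (∑Δ-cong w λ u v → +-identityˡ _)

  ∑-cut-≡ : ∀ l p w H → ∑-cut (l ∷ p) (l ∷ w) H ≈ ∑-cut p w H + ∑-cut (l ∷ p) w (λ v → H (l ∷ v))
  ∑-cut-≡ l p w H = ≈-trans (∑Δ-∷′ l w _) (+-congʳ (∑Δ-cong w λ u v →
    reflexive (cong (λ e → (e ∧ (p =ʷ u)) ▷ H v) (dec-true (l ℕ.≟ l) ≡.refl))))

  ∑-cut-≢ : ∀ {k l} → k ≢ l → ∀ p w H → ∑-cut (k ∷ p) (l ∷ w) H ≈ ∑-cut (k ∷ p) w (λ v → H (l ∷ v))
  ∑-cut-≢ {k} {l} k≢l p w H = ≈-trans (∑Δ-∷ l w _) (∑Δ-cong w λ u v → ≈-trans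
    (+-congʳ (reflexive (cong (λ e → (e ∧ (p =ʷ u)) ▷ H v) (dec-false (k ℕ.≟ l) k≢l))))
    (+-identityˡ _))

  data Cut (p w : Word) : Set (c ⊔ ℓ) where
    rest   : ∀ v → Interleaving p v w → (∀ H → ∑-cut p w H ≈ H v) → Cut p w
    absent : (∀ v → ¬ Interleaving p v w) → (∀ H → ∑-cut p w H ≈ 0#) → Cut p w

  -- If p and w begin with the same letter, that letter is missing from the tail of w. The second
  -- summand of `∑-cut-≡` then vanishes and the two heads must be matched.
  cut : ∀ p w → Unique w → Cut p w
  cut []      []      _  = rest [] [] (λ H → +-identityʳ _)
  cut (_ ∷ _) []      _  = absent (λ v ()) (λ H → +-identityʳ _)
  cut []      (l ∷ w) (_ ∷ w!) with cut [] w w!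
  ... | rest v i eq = rest (l ∷ v) (consʳ i) λ H → ≈-trans (∑-cut-[]-∷ l w H) (eq _)
  ... | absent ∄ eq = absent (λ { (_ ∷ v) (consʳ i) → ∄ v i }) λ H → ≈-trans (∑-cut-[]-∷ l w H) (eq _)
  cut (k ∷ p) (l ∷ w) (l∉ ∷ w!) with k ℕ.≟ l | cut (k ∷ p) w w!
  ... | no k≢l     | rest v i eq = rest (l ∷ v) (consʳ i) λ H → ≈-trans (∑-cut-≢ k≢l p w H) (eq _)
  ... | no k≢l     | absent ∄ eq = absent
          (λ { v (consˡ i) → k≢l ≡.refl ; (_ ∷ v) (consʳ i) → ∄ v i })
          λ H → ≈-trans (∑-cut-≢ k≢l p w H) (eq _)
  ... | yes ≡.refl | rest v i _  =
          contradiction ≡.refl (All.lookup l∉ (∈-resp-↭ (↭-sym (toPermutation i)) (here ≡.refl)))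
  ... | yes ≡.refl | absent ∄ eq with cut p w w!
  ...   | rest v i eq′ = rest v (consˡ i) λ H →
            ≈-trans (∑-cut-≡ k p w H) (≈-trans (+-cong (eq′ H) (eq _)) (+-identityʳ _))
  ...   | absent ∄′ eq′ = absent
            (λ { v (consˡ i) → ∄′ v i ; (_ ∷ v) (consʳ i) → ∄ v i })
            λ H → ≈-trans (∑-cut-≡ k p w H) (≈-trans (+-cong (eq′ H) (eq _)) (+-identityʳ _))

  -- For u as long as p, the equation p q = u y separates into p = u and q = y. For other lengths
  -- both sides are 0.
  δ-++ : ∀ p q u y → (length u ≡ᵇ length p) ▷ δ (p ++ q) (u ++ y) ≈ (p =ʷ u) ▷ δ q y
  δ-++ []      q []      y = refl
  δ-++ []      q (_ ∷ _) y = refl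
  δ-++ (_ ∷ _) q []      y = refl
  δ-++ (k ∷ p) q (l ∷ u) y with does (k ℕ.≟ l)
  ... | true  = δ-++ p q u y
  ... | false with length u ≡ᵇ length p
  ...   | true  = refl
  ...   | false = refl

  ∑X-cut : ∀ γ p q w → ∑ (X (length p ∷ γ) w) (δ (p ++ q)) ≈ ∑-cut p w λ v → ∑ (X γ v) (δ q)
  ∑X-cut γ p q w = ≈-trans (∑X-∷ (length p) γ w _) (∑Δ-cong w λ u v → begin
    (length u ≡ᵇ length p) ▷ ∑ (X γ v) (λ y → δ (p ++ q) (u ++ y)) ≈⟨ ▷-∑ (length u ≡ᵇ length p) (X γ v) _ ⟩
    ∑ (X γ v) (λ y → (length u ≡ᵇ length p) ▷ δ (p ++ q) (u ++ y)) ≈⟨ ∑-cong (X γ v) (δ-++ p q u) ⟩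
    ∑ (X γ v) (λ y → (p =ʷ u) ▷ δ q y)                            ≈⟨ ▷-∑ (p =ʷ u) (X γ v) _ ⟨
    (p =ʷ u) ▷ ∑ (X γ v) (δ q)                                    ∎)

  -- The first factor of X_γ must pick the first block out of w. Distinct letters leave at most one
  -- way, and since w is increasing there is one exactly when the block is increasing. The
  -- complement is increasing again, so the induction continues.
  blocks-coeff : ∀ γ {w s} → AllPairs _<_ w → Unique s → All (_∈ w) s →
                 length s ≡ length w → sum γ ≡ length w →
                 (Blocks γ s × ∑ (X γ w) (δ s) ≈ 1#) ⊎ (¬ Blocks γ s × ∑ (X γ w) (δ s) ≈ 0#)
  blocks-coeff []      {[]} {[]} _ _ _ _ _ = inj₁ (tt , +-identityʳ _)
  blocks-coeff (a ∷ γ) {w} {s} w< s! s⊆ |s|≡|w| Σ≡|w| = case (cut p w (AllPairs.map ℕ.<⇒≢ w<))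
    where
    p = take a s
    q = drop a s

    |p|≡a : length p ≡ a
    |p|≡a = ≡.trans (List.length-take a s)
      (ℕ.m≤n⇒m⊓n≡m (subst (a ≤_) (≡.trans Σ≡|w| (≡.sym |s|≡|w|)) (ℕ.m≤m+n a (sum γ))))

    reduce : ∑ (X (a ∷ γ) w) (δ s) ≈ ∑-cut p w λ v → ∑ (X γ v) (δ q)
    reduce = subst₂ (λ n z → ∑ (X (n ∷ γ) w) (δ z) ≈ ∑-cut p w λ v → ∑ (X γ v) (δ q))
      |p|≡a (List.take++drop≡id a s) (∑X-cut γ p q w)

    case : Cut p w → (Blocks (a ∷ γ) s × ∑ (X (a ∷ γ) w) (δ s) ≈ 1#) ⊎
                     (¬ Blocks (a ∷ γ) s × ∑ (X (a ∷ γ) w) (δ s) ≈ 0#)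
    case (absent ∄ eq) = inj₂ ((λ (inc , _) → uncurry ∄
        (sorted⇒interleaving p w (Linked.Linked⇒AllPairs ℕ.<-trans inc) w< (All.take⁺ a s⊆))) ,
      ≈-trans reduce (eq _))
    case (rest v i eq) =
      let q⊆v , |q|≡|v| , Σγ≡|v| = interleaving-drop a i |p|≡a s! s⊆ |s|≡|w| Σ≡|w|
          p< , v< = interleaving-AllPairs i w<
      in Sum.map (λ (b , ≈1) → (Linked.AllPairs⇒Linked p< , b) , ≈-trans reduce (≈-trans (eq _) ≈1))
                 (λ (¬b , ≈0) → (λ (_ , b) → ¬b b) , ≈-trans reduce (≈-trans (eq _) ≈0))
                 (blocks-coeff γ v< (Unique.drop⁺ a s!) q⊆v |q|≡|v| Σγ≡|v|)

  -- The guard is essential: `boundaries γ (k ∸ 1)` is a subset also when `sum γ` is not k, but X_γ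
  -- then vanishes in degree k.
  ∑X-permWord : ∀ k γ (σ : Permutation′ k) → ∑ (X γ (identityWord k)) (δ (permWord σ)) ≈
                (sum γ ≡ᵇ k) ▷ XJcoeff k (boundaries γ (k ∸ 1)) σ
  ∑X-permWord k γ σ with sum γ ℕ.≟ k
  ... | no Σ≢k = begin
    ∑ (X γ (identityWord k)) (δ (permWord σ))
      ≈⟨ ∑-cong-∈ (X γ (identityWord k)) (λ x∈ → contradiction (≡.trans (≡.sym (X-length γ _ x∈))
           (≡.trans (↭-length (X-↭ γ _ x∈)) (List.length-tabulate {n = k} toℕ))) Σ≢k) ⟩
    ∑ (X γ (identityWord k)) (λ _ → 0#) ≈⟨ ∑-zero (X γ (identityWord k)) ⟩
    0#                                  ≡⟨ cong (_▷ XJcoeff k (boundaries γ (k ∸ 1)) σ) (dec-false (sum γ ℕ.≟ k) Σ≢k) ⟨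
    (sum γ ≡ᵇ k) ▷ XJcoeff k (boundaries γ (k ∸ 1)) σ ∎
  ... | yes Σ≡k = ≈-trans (indicator (blocks-coeff γ (identityWord-sorted k)
      (Unique.tabulate⁺ (permWord-injective σ)) (All.tabulate⁺ λ i → ∈-tabulate⁺ (σ ⟨$⟩ʳ i))
      (≡.trans (List.length-tabulate (λ i → toℕ (σ ⟨$⟩ʳ i))) (≡.sym |id|≡k)) (≡.trans Σ≡k (≡.sym |id|≡k))))
    (reflexive (cong (_▷ XJcoeff k (boundaries γ (k ∸ 1)) σ) (≡.sym (dec-true (sum γ ℕ.≟ k) Σ≡k))))
    where
    |id|≡k = List.length-tabulate {n = k} toℕ
    open Equivalence (desSubset⇔blocks k γ σ Σ≡k)
    indicator : ∀ {x} → (Blocks γ (permWord σ) × x ≈ 1#) ⊎ (¬ Blocks γ (permWord σ) × x ≈ 0#) →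
                x ≈ XJcoeff k (boundaries γ (k ∸ 1)) σ
    indicator p with desSubset k σ (boundaries γ (k ∸ 1)) in d
    indicator (inj₁ (_ , x≈1))  | true  = x≈1
    indicator (inj₂ (¬b , _))   | true  = contradiction (to d) ¬b
    indicator (inj₁ (b , _))    | false = contradiction (≡.trans (≡.sym d) (from b)) λ ()
    indicator (inj₂ (_ , x≈0))  | false = x≈0

  -- From combinations of X_γ to Σ

  ∑-allSubsets : ∀ n (K : Vec Bool n) (f : Vec Bool n → Carrier) →
                 ∑ (allSubsets n) (λ J → does (Vec.≡-dec Bool._≟_ K J) ▷ f J) ≈ f K
  ∑-allSubsets zero    []          f = +-identityʳ _
  ∑-allSubsets (suc n) (true ∷ K)  f = ≈-trans (∑-concatMap _ (allSubsets n) _)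
    (≈-trans (∑-cong (allSubsets n) λ J → ≈-trans (+-congˡ (+-identityʳ _)) (+-identityʳ _))
             (∑-allSubsets n K (f ∘ (true ∷_))))
  ∑-allSubsets (suc n) (false ∷ K) f = ≈-trans (∑-concatMap _ (allSubsets n) _)
    (≈-trans (∑-cong (allSubsets n) λ J → ≈-trans (+-identityˡ _) (+-identityʳ _))
             (∑-allSubsets n K (f ∘ (false ∷_))))

  XSpan⇒InΣ : ∀ F → XSpan F → InΣ F
  XSpan⇒InΣ F (G , F≈) k = cJ , λ σ → begin
    coeffPerm F k σ
      ≈⟨ coeff≈⟪⟫δ (permWord σ) (F (identityWord k)) ⟩
    ⟪ F (identityWord k) ⟫ (δ (permWord σ))
      ≈⟨ F≈ (identityWord k) _ ⟩
    ∑₂ G (λ r γ → r * ∑ (X γ (identityWord k)) (δ (permWord σ)))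
      ≈⟨ ∑₂-cong G (λ r γ → *-congˡ (∑X-permWord k γ σ)) ⟩
    ∑₂ G (λ r γ → r * ((sum γ ≡ᵇ k) ▷ XJcoeff k (boundaries γ (k ∸ 1)) σ))
      ≈⟨ ∑₂-cong G (λ r γ → ≈-trans (*-▷ r (sum γ ≡ᵇ k) _) (▷-cong (sum γ ≡ᵇ k)
           (≈-sym (∑-allSubsets (k ∸ 1) (boundaries γ (k ∸ 1)) λ J → r * XJcoeff k J σ)))) ⟩
    ∑₂ G (λ r γ → (sum γ ≡ᵇ k) ▷ ∑ (allSubsets (k ∸ 1)) λ J → does (Vec.≡-dec Bool._≟_ (boundaries γ (k ∸ 1)) J) ▷ r * XJcoeff k J σ)
      ≈⟨ ∑₂-cong G (λ r γ → ▷-∑ (sum γ ≡ᵇ k) (allSubsets (k ∸ 1)) _) ⟩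
    ∑₂ G (λ r γ → ∑ (allSubsets (k ∸ 1)) λ J → (sum γ ≡ᵇ k) ▷ does (Vec.≡-dec Bool._≟_ (boundaries γ (k ∸ 1)) J) ▷ r * XJcoeff k J σ)
      ≈⟨ ∑-swap G (allSubsets (k ∸ 1)) _ ⟩
    ∑ (allSubsets (k ∸ 1)) (λ J → ∑₂ G λ r γ → (sum γ ≡ᵇ k) ▷ does (Vec.≡-dec Bool._≟_ (boundaries γ (k ∸ 1)) J) ▷ r * XJcoeff k J σ)
      ≈⟨ ∑-cong (allSubsets (k ∸ 1)) (λ J → ≈-trans (∑₂-cong G λ r γ → ≈-trans
             (▷-cong (sum γ ≡ᵇ k) (≈-sym (▷-* (does (Vec.≡-dec Bool._≟_ (boundaries γ (k ∸ 1)) J)) r (XJcoeff k J σ))))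
             (≈-sym (▷-* (sum γ ≡ᵇ k) _ (XJcoeff k J σ))))
           (∑-distribʳ G _ (XJcoeff k J σ))) ⟩
    ∑ (allSubsets (k ∸ 1)) (λ J → cJ J * XJcoeff k J σ) ∎
    where
    -- Weak compositions that differ by zero parts give the same subset, so c_J collects the
    -- coefficients of all γ of degree k with subset J.
    cJ : Vec Bool (k ∸ 1) → Carrier
    cJ J = ∑₂ G λ r γ → (sum γ ≡ᵇ k) ▷ does (Vec.≡-dec Bool._≟_ (boundaries γ (k ∸ 1)) J) ▷ r

  -- Naturality in the letters, and boundedness of degree

  actTerm : Word → Carrier × Σ ℕ Permutation′ → T1
  actTerm w (r , n , σ) with length w ℕ.≟ n
  ... | yes eq = (r , act σ w eq) ∷ []
  ... | no _   = []

  -- The step function of endo is local to it and depends on all of x, so it is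
  -- reached by unification.
  endo-step : ∀ x w → ∃ λ step → endo x w ≡ concatMap step x
  endo-step x w = _ , ≡.refl

  endo-step≗actTerm : ∀ x w e → proj₁ (endo-step x w) e ≡ actTerm w e
  endo-step≗actTerm x w (r , n , σ) with length w ℕ.≟ n
  ... | yes _ = ≡.refl
  ... | no _  = ≡.refl

  endo≡ : ∀ x w → endo x w ≡ concatMap (actTerm w) x
  endo≡ x w = List.concatMap-cong (endo-step≗actTerm x w) x

  act-map : ∀ {n} (σ : Permutation′ n) (g : ℕ → ℕ) w eq eq′ → act σ (map g w) eq ≡ map g (act σ w eq′)
  act-map σ g w eq eq′ = ≡.trans
    (List.tabulate-cong λ i → lookup-map-cast g w (σ ⟨$⟩ʳ i)) (≡.sym (List.map-tabulate _ g))

  -- Permuting positions commutes with substituting letters, even when the substitution identifies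
  -- some of them.
  ⟪endo⟫-map : ∀ x (g : ℕ → ℕ) w h → ⟪ endo x (map g w) ⟫ h ≈ ⟪ endo x w ⟫ (h ∘ map g)
  ⟪endo⟫-map x g w h = begin
    ⟪ endo x (map g w) ⟫ h                   ≡⟨ cong (λ t → ⟪ t ⟫ h) (endo≡ x (map g w)) ⟩
    ⟪ concatMap (actTerm (map g w)) x ⟫ h    ≈⟨ ∑-concatMap (actTerm (map g w)) x _ ⟩
    ∑ x (λ e → ⟪ actTerm (map g w) e ⟫ h)    ≈⟨ ∑-cong x term ⟩
    ∑ x (λ e → ⟪ actTerm w e ⟫ (h ∘ map g))  ≈⟨ ∑-concatMap (actTerm w) x _ ⟨
    ⟪ concatMap (actTerm w) x ⟫ (h ∘ map g)  ≡⟨ cong (λ t → ⟪ t ⟫ (h ∘ map g)) (endo≡ x w) ⟨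
    ⟪ endo x w ⟫ (h ∘ map g)                 ∎
    where
    term : ∀ e → ⟪ actTerm (map g w) e ⟫ h ≈ ⟪ actTerm w e ⟫ (h ∘ map g)
    term (r , n , σ) with length (map g w) ℕ.≟ n | length w ℕ.≟ n
    ... | yes eq | yes eq′ = +-congʳ (*-congˡ (reflexive (cong h (act-map σ g w eq eq′))))
    ... | yes eq | no ≢n   = contradiction (≡.trans (≡.sym (List.length-map g w)) eq) ≢n
    ... | no ≢n  | yes eq  = contradiction (≡.trans (List.length-map g w) eq) ≢n
    ... | no _   | no _    = refl

  act-identityWord : ∀ {n} (σ : Permutation′ n) eq → act σ (identityWord n) eq ≡ permWord σ
  act-identityWord σ eq = List.tabulate-cong λ i → List.lookup-tabulate toℕ (σ ⟨$⟩ʳ i)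

  ∈-endo-identityWord : ∀ x n {r s} → (r , s) ∈ endo x (identityWord n) → ∃ λ (σ : Permutation′ n) → s ≡ permWord σ
  ∈-endo-identityWord x n {r} {s} rs∈
    with find (∈-concatMap⁻ (actTerm (identityWord n)) {xs = x} (subst ((r , s) ∈_) (endo≡ x (identityWord n)) rs∈))
  ... | (_ , m , σ) , _ , rs∈e = term m σ rs∈e
    where
    term : ∀ {r′} m (σ : Permutation′ m) → (r , s) ∈ actTerm (identityWord n) (r′ , m , σ) → ∃ λ (σ : Permutation′ n) → s ≡ permWord σ
    term m σ rs∈e with length (identityWord n) ℕ.≟ m
    term m σ (here ≡.refl) | yes eq with ≡.trans (≡.sym (List.length-tabulate {n = n} toℕ)) eq
    ... | ≡.refl = σ , act-identityWord σ eq

  -- `InΣ` supplies coefficients degree by degree. Since x is a finite sum, this bound lets finitely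
  -- many degrees suffice for `XSpan`.
  degreeBound : SElem → ℕ
  degreeBound []                = 0
  degreeBound ((_ , n , _) ∷ x) = n ℕ.⊔ degreeBound x

  endo-vanishes : ∀ x w → degreeBound x < length w → endo x w ≡ []
  endo-vanishes x w bound<|w| = ≡.trans (endo≡ x w) (vanishes x bound<|w|)
    where
    vanishes : ∀ x → degreeBound x < length w → concatMap (actTerm w) x ≡ []
    vanishes []                bound<|w| = ≡.refl
    vanishes ((_ , n , _) ∷ x) bound<|w| with length w ℕ.≟ n
    ... | yes eq = contradiction eq (ℕ.>⇒≢ (ℕ.≤-<-trans (ℕ.m≤m⊔n n _) bound<|w|))
    ... | no _   = vanishes x (ℕ.≤-<-trans (ℕ.m≤n⊔m n _) bound<|w|)

  ∑Δ-map : ∀ (g : ℕ → ℕ) w H → ∑Δ (map g w) H ≈ ∑Δ w λ u v → H (map g u) (map g v)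
  ∑Δ-map g []      H = refl
  ∑Δ-map g (l ∷ w) H = begin
    ∑Δ (g l ∷ map g w) H                                        ≈⟨ ∑Δ-∷ (g l) (map g w) H ⟩
    ∑Δ (map g w) (λ u v → H (g l ∷ u) v + H u (g l ∷ v))        ≈⟨ ∑Δ-map g w _ ⟩
    _                                                           ≈⟨ ∑Δ-∷ l w _ ⟨
    ∑Δ (l ∷ w) (λ u v → H (map g u) (map g v))                  ∎

  -- Dealing depends only on positions and lengths, never on the letters.
  ∑X-map : ∀ α (g : ℕ → ℕ) w h → ∑ (X α (map g w)) h ≈ ∑ (X α w) (h ∘ map g)
  ∑X-map []      g []      h = refl
  ∑X-map []      g (_ ∷ _) h = refl
  ∑X-map (a ∷ α) g w       h = begin
    ∑ (X (a ∷ α) (map g w)) h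
      ≈⟨ ∑X-∷ a α (map g w) h ⟩
    ∑Δ (map g w) (λ u v → (length u ≡ᵇ a) ▷ ∑ (X α v) λ p → h (u ++ p))
      ≈⟨ ∑Δ-map g w _ ⟩
    ∑Δ w (λ u v → (length (map g u) ≡ᵇ a) ▷ ∑ (X α (map g v)) λ p → h (map g u ++ p))
      ≈⟨ ∑Δ-cong w (λ u v → ≈-trans
           (reflexive (cong (λ n → (n ≡ᵇ a) ▷ ∑ (X α (map g v)) λ p → h (map g u ++ p)) (List.length-map g u)))
           (▷-cong (length u ≡ᵇ a) (≈-trans (∑X-map α g v _)
             (∑-cong (X α v) λ p → reflexive (cong h (≡.sym (List.map-++ g u p))))))) ⟩
    ∑Δ w (λ u v → (length u ≡ᵇ a) ▷ ∑ (X α v) λ p → h (map g (u ++ p)))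
      ≈⟨ ∑X-∷ a α w _ ⟨
    ∑ (X (a ∷ α) w) (h ∘ map g) ∎

  ∑X-vanishes : ∀ α w h → sum α ≢ length w → ∑ (X α w) h ≈ 0#
  ∑X-vanishes α w h Σ≢|w| = ≈-trans
    (∑-cong-∈ (X α w) λ x∈ → contradiction (≡.trans (≡.sym (X-length α w x∈)) (↭-length (X-↭ α w x∈))) Σ≢|w|)
    (∑-zero (X α w))

  -- From Σ to combinations of X_γ

  support : T1 → List Word
  support = map proj₂

  -- A term (r , u) contributes to the right side only at s = u, and L contains u exactly once.
  ⟪⟫-by-coeff : ∀ {L} → Unique L → ∀ t h → All (_∈ L) (support t) → ⟪ t ⟫ h ≈ ∑ L λ s → ⟪ t ⟫ (δ s) * h s
  ⟪⟫-by-coeff {L} L! []            h []        = ≈-sym (≈-trans (∑-cong L λ s → zeroˡ _) (∑-zero L))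
  ⟪⟫-by-coeff {L} L! ((r , u) ∷ t) h (u∈ ∷ t⊆) = ≈-sym (begin
    ∑ L (λ s → (r * δ s u + ⟪ t ⟫ (δ s)) * h s)
      ≈⟨ ∑-cong L (λ s → distribʳ _ _ _) ⟩
    ∑ L (λ s → (r * δ s u) * h s + ⟪ t ⟫ (δ s) * h s)
      ≈⟨ ∑-distrib-+ L _ _ ⟩
    ∑ L (λ s → (r * δ s u) * h s) + ∑ L (λ s → ⟪ t ⟫ (δ s) * h s)
      ≈⟨ +-cong (∑-unique L! u∈ λ {s} _ s≢u → off s s≢u) (≈-sym (⟪⟫-by-coeff L! t h t⊆)) ⟩
    (r * δ u u) * h u + ⟪ t ⟫ h
      ≈⟨ +-congʳ (*-congʳ (≈-trans (*-congˡ (reflexive (cong (_▷ 1#) (dec-true (List.≡-dec ℕ._≟_ u u) ≡.refl)))) (*-identityʳ r))) ⟩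
    r * h u + ⟪ t ⟫ h ∎)
    where
    off : ∀ s → s ≢ u → (r * δ s u) * h s ≈ 0#
    off s s≢u = ≈-trans (*-congʳ (≈-trans
      (*-congˡ (reflexive (cong (_▷ 1#) (dec-false (List.≡-dec ℕ._≟_ s u) s≢u)))) (zeroʳ r))) (zeroˡ _)

  -- Testing on the two supports is enough. This suits `InΣ`, which gives information only on
  -- coefficients of words of permutations.
  coeff-determines : ∀ t t′ → (∀ {s} → s ∈ support t ++ support t′ → ⟪ t ⟫ (δ s) ≈ ⟪ t′ ⟫ (δ s)) →
                     ∀ h → ⟪ t ⟫ h ≈ ⟪ t′ ⟫ h
  coeff-determines t t′ t≈t′ h = begin
    ⟪ t ⟫ h                        ≈⟨ ⟪⟫-by-coeff L! t h (All.tabulate λ s∈ → ∈-deduplicate⁺ _≟ʷ_ (∈-++⁺ˡ s∈)) ⟩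
    ∑ L (λ s → ⟪ t ⟫ (δ s) * h s)  ≈⟨ ∑-cong-∈ L (λ s∈ → *-congʳ (t≈t′ (∈-deduplicate⁻ _≟ʷ_ _ s∈))) ⟩
    ∑ L (λ s → ⟪ t′ ⟫ (δ s) * h s) ≈⟨ ⟪⟫-by-coeff L! t′ h (All.tabulate λ s∈ → ∈-deduplicate⁺ _≟ʷ_ (∈-++⁺ʳ (support t) s∈)) ⟨
    ⟪ t′ ⟫ h                       ∎
    where
    _≟ʷ_ = List.≡-dec ℕ._≟_
    L = deduplicate _≟ʷ_ (support t ++ support t′)
    L! = DecUnique.deduplicate-! _≟ʷ_ (support t ++ support t′)

  module _ (x : SElem) (x∈Σ : InΣ (endo x)) where
    degreePart : ℕ → List (Carrier × List ℕ)
    degreePart n = map (λ J → proj₁ (x∈Σ n) J , composition n J) (allSubsets (n ∸ 1))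

    expansion : ℕ → T1
    expansion n = concatMap (λ (r , γ) → map (r ,_) (X γ (identityWord n))) (degreePart n)

    ⟪expansion⟫ : ∀ n h → ⟪ expansion n ⟫ h ≈ ∑₂ (degreePart n) λ r γ → r * ∑ (X γ (identityWord n)) h
    ⟪expansion⟫ n h = ≈-trans (∑-concatMap _ (degreePart n) _) (∑₂-cong (degreePart n) λ r γ →
      ≈-trans (reflexive (∑-map (r ,_) (X γ (identityWord n)) _)) (∑-distribˡ (X γ (identityWord n)) r h))

    support⇒permWord : ∀ n {s} → s ∈ support (endo x (identityWord n)) ++ support (expansion n) →
                       ∃ λ (σ : Permutation′ n) → s ≡ permWord σ
    support⇒permWord n s∈ with ∈-++⁻ (support (endo x (identityWord n))) s∈
    ... | inj₁ s∈ with ∈-map⁻ proj₂ s∈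
    ...   | _ , rs∈ , ≡.refl = ∈-endo-identityWord x n rs∈
    support⇒permWord n s∈ | inj₂ s∈′ with ∈-map⁻ proj₂ s∈′
    ...   | _ , rs∈ , ≡.refl with find (∈-concatMap⁻ _ {xs = degreePart n} rs∈)
    ...     | (r , γ) , _ , rs∈γ with ∈-map⁻ (r ,_) rs∈γ
    ...       | _ , s∈X , ≡.refl = ↭-identityWord⇒permWord n (X-↭ γ (identityWord n) s∈X)

    coeff-expansion : ∀ n (σ : Permutation′ n) →
                      ⟪ endo x (identityWord n) ⟫ (δ (permWord σ)) ≈ ⟪ expansion n ⟫ (δ (permWord σ))
    coeff-expansion n σ = begin
      ⟪ endo x (identityWord n) ⟫ (δ (permWord σ))
        ≈⟨ coeff≈⟪⟫δ (permWord σ) (endo x (identityWord n)) ⟨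
      coeffPerm (endo x) n σ
        ≈⟨ proj₂ (x∈Σ n) σ ⟩
      ∑ (allSubsets (n ∸ 1)) (λ J → proj₁ (x∈Σ n) J * XJcoeff n J σ)
        ≈⟨ ∑-cong (allSubsets (n ∸ 1)) (λ J → *-congˡ (begin
          XJcoeff n J σ
            ≡⟨ cong₂ (λ e K → e ▷ XJcoeff n K σ) (dec-true (sum (composition n J) ℕ.≟ n) (sum-composition n J)) (boundaries-composition n J) ⟨
          (sum (composition n J) ≡ᵇ n) ▷ XJcoeff n (boundaries (composition n J) (n ∸ 1)) σ
            ≈⟨ ∑X-permWord n (composition n J) σ ⟨
          ∑ (X (composition n J) (identityWord n)) (δ (permWord σ)) ∎)) ⟩
      ∑ (allSubsets (n ∸ 1)) (λ J → proj₁ (x∈Σ n) J * ∑ (X (composition n J) (identityWord n)) (δ (permWord σ)))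
        ≡⟨ ∑-map _ (allSubsets (n ∸ 1)) _ ⟨
      ∑₂ (degreePart n) (λ r γ → r * ∑ (X γ (identityWord n)) (δ (permWord σ)))
        ≈⟨ ⟪expansion⟫ n _ ⟨
      ⟪ expansion n ⟫ (δ (permWord σ)) ∎

    ⟪endo⟫-identityWord : ∀ n h → ⟪ endo x (identityWord n) ⟫ h ≈ ∑₂ (degreePart n) λ r γ → r * ∑ (X γ (identityWord n)) h
    ⟪endo⟫-identityWord n h = ≈-trans
      (coeff-determines (endo x (identityWord n)) (expansion n) (λ s∈ → on-support (support⇒permWord n s∈)) h)
      (⟪expansion⟫ n h)
      where
      on-support : ∀ {s} → (∃ λ (σ : Permutation′ n) → s ≡ permWord σ) →
                   ⟪ endo x (identityWord n) ⟫ (δ s) ≈ ⟪ expansion n ⟫ (δ s)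
      on-support (σ , ≡.refl) = coeff-expansion n σ

    -- Both sides are natural in the letters, so the identity on 0 1 ... n-1 passes to w along the
    -- substitution `nth w`.
    ⟪endo⟫-degree : ∀ w h → ⟪ endo x w ⟫ h ≈ ∑₂ (degreePart (length w)) λ r γ → r * ∑ (X γ w) h
    ⟪endo⟫-degree w h = subst (λ z → ⟪ endo x z ⟫ h ≈ ∑₂ (degreePart n) λ r γ → r * ∑ (X γ z) h)
      (map-nth-identityWord w) (begin
      ⟪ endo x (map (nth w) (identityWord n)) ⟫ h
        ≈⟨ ⟪endo⟫-map x (nth w) (identityWord n) h ⟩
      ⟪ endo x (identityWord n) ⟫ (h ∘ map (nth w))
        ≈⟨ ⟪endo⟫-identityWord n _ ⟩
      ∑₂ (degreePart n) (λ r γ → r * ∑ (X γ (identityWord n)) (h ∘ map (nth w)))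
        ≈⟨ ∑₂-cong (degreePart n) (λ r γ → *-congˡ (∑X-map γ (nth w) (identityWord n) h)) ⟨
      ∑₂ (degreePart n) (λ r γ → r * ∑ (X γ (map (nth w) (identityWord n))) h) ∎)
      where n = length w

    -- On a given word only the degree equal to its length contributes to the combined list. On
    -- words longer than the bound both sides are zero.
    InΣ⇒XSpan : XSpan (endo x)
    InΣ⇒XSpan = concatMap degreePart degrees , λ w h →
      ≈-trans (in-degree w h (length w ℕ.≤? degreeBound x)) (≈-sym (∑-concatMap degreePart degrees _))
      where
      -- `upTo` excludes its argument, and the degree equal to the bound is needed.
      degrees = upTo (suc (degreeBound x))

      other-degree : ∀ w h n → n ≢ length w → ∑₂ (degreePart n) (λ r γ → r * ∑ (X γ w) h) ≈ 0#
      other-degree w h n n≢ = ≈-trans (reflexive (∑-map _ (allSubsets (n ∸ 1)) _))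
        (≈-trans (∑-cong (allSubsets (n ∸ 1)) λ J → ≈-trans
          (*-congˡ (∑X-vanishes (composition n J) w h (n≢ ∘ ≡.trans (≡.sym (sum-composition n J))))) (zeroʳ _))
          (∑-zero (allSubsets (n ∸ 1))))

      in-degree : ∀ w h → Dec (length w ≤ degreeBound x) →
                  ⟪ endo x w ⟫ h ≈ ∑ degrees λ n → ∑₂ (degreePart n) λ r γ → r * ∑ (X γ w) h
      in-degree w h (yes |w|≤) = ≈-trans (⟪endo⟫-degree w h)
        (≈-sym (∑-unique (Unique.upTo⁺ (suc (degreeBound x))) (∈-upTo⁺ (s≤s |w|≤)) λ {n} _ → other-degree w h n))
      in-degree w h (no |w|≰) = ≈-trans
        (reflexive (cong (λ t → ⟪ t ⟫ h) (endo-vanishes x w (ℕ.≰⇒> |w|≰))))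
        (≈-sym (≈-trans
          (∑-cong-∈ degrees λ {n} n∈ → other-degree w h n λ { ≡.refl → |w|≰ (ℕ.≤-pred (∈-upTo⁻ n∈)) })
          (∑-zero degrees)))

theorem3p1 : ∀ {c ℓ : Level} (𝕜 : Char0Field c ℓ) →
    let open WithRing (Char0Field.cring 𝕜) in
    (x y : SElem) → InΣ (endo x) → InΣ (endo y) → InΣ (endo x # endo y)
theorem3p1 𝕜 x y x∈Σ y∈Σ =
  XSpan⇒InΣ (endo x # endo y) (XSpan-# (endo x) (endo y) (InΣ⇒XSpan x x∈Σ) (InΣ⇒XSpan y y∈Σ))
  where
  open WithRing (Char0Field.cring 𝕜)
  open LinearCombinations (Char0Field.cring 𝕜)
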